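{- For all odd integers $n\ge 5$ and all odd integers $H\ge 3$, $$ \#\mathcal{I}_n^+(H) \;\ge\; \frac{1}{2n}\,(H-1)^{(n-1)^2/4}. $$
   Context: For positive integers $n$ and $H$, let $\mathcal{M}_n^+(\mathbb{Z};H)$ denote the set of $n\times n$ matrices $A=(a_{ij})$ with integer entries $a_{ij}\in\{0,1,\ldots,H\}$. Let $\mathcal{I}_n^+(H)$ denote the set of distinct polynomials $f\in\mathbb{Z}[X]$ that are irreducible over $\mathbb{Q}$ and occur as the characteristic polynomial $\det(XI_n - A)$ of some matrix $A\in\mathcal{M}_n^+(\mathbb{Z};H)$. -}

module Defs where

open import Level using (Level)
open import Algebra.Bundles using (CommutativeRing)
open import Data.Nat as ℕ using (ℕ; zero; suc)
open import Data.Fin using (Fin; zero; suc; toℕ; punchIn; _≟_)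
open import Data.List using (List; []; _∷_; map; length)
open import Data.List.Relation.Unary.All using (All)
open import Data.List.Relation.Unary.AllPairs using (AllPairs)
open import Data.Product using (Σ; _×_; ∃)
open import Data.Sum using (_⊎_)
open import Relation.Nullary using (¬_; yes; no)
open import Data.Integer as ℤ using (ℤ)
import Data.Integer.Properties as ℤP
open import Data.Rational as ℚ using (ℚ)
import Data.Rational.Properties as ℚP

-- Univariate polynomials over a commutative ring R, represented by their
-- coefficient lists (constant term first); trailing zeros are allowed and
-- polynomial equality is coefficientwise equality (_≈ₚ_).
module Poly {c ℓ : Level} (R : CommutativeRing c ℓ) where
  open CommutativeRing R using (Carrier; _≈_; 0#; 1#; _+_; _*_; -_)

  P : Set c
  P = List Carrier

  coeff : P → ℕ → Carrier
  coeff []      _       = 0#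
  coeff (a ∷ p) zero    = a
  coeff (a ∷ p) (suc k) = coeff p k

  _≈ₚ_ : P → P → Set ℓ
  p ≈ₚ q = ∀ k → coeff p k ≈ coeff q k

  zeroₚ : P
  zeroₚ = []

  oneₚ : P
  oneₚ = 1# ∷ []

  constₚ : Carrier → P
  constₚ a = a ∷ []

  Xₚ : P
  Xₚ = 0# ∷ 1# ∷ []

  _+ₚ_ : P → P → P
  []      +ₚ q       = q
  (a ∷ p) +ₚ []      = a ∷ p
  (a ∷ p) +ₚ (b ∷ q) = (a + b) ∷ (p +ₚ q)

  -ₚ_ : P → P
  -ₚ p = map -_ p

  _-ₚ_ : P → P → P
  p -ₚ q = p +ₚ (-ₚ q)

  scaleₚ : Carrier → P → P
  scaleₚ a p = map (a *_) p

  _*ₚ_ : P → P → P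
  []      *ₚ q = []
  (a ∷ p) *ₚ q = scaleₚ a q +ₚ (0# ∷ (p *ₚ q))

  sumFin : (n : ℕ) → (Fin n → P) → P
  sumFin zero    f = zeroₚ
  sumFin (suc n) f = f zero +ₚ sumFin n (λ j → f (suc j))

  signₚ : ℕ → P
  signₚ zero          = oneₚ
  signₚ (suc zero)    = -ₚ oneₚ
  signₚ (suc (suc k)) = signₚ k

  det : (n : ℕ) → (Fin n → Fin n → P) → P
  det zero    M = oneₚ
  det (suc n) M =
    sumFin (suc n) (λ j → (signₚ (toℕ j) *ₚ M zero j)
                           *ₚ det n (λ i k → M (suc i) (punchIn j k)))

  IsUnitₚ : P → Set (c Level.⊔ ℓ)
  IsUnitₚ g = Σ P (λ u → (g *ₚ u) ≈ₚ oneₚ)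

  Irreducibleₚ : P → Set (c Level.⊔ ℓ)
  Irreducibleₚ f =
    (¬ (f ≈ₚ zeroₚ)) × (¬ IsUnitₚ f) ×
    (∀ g h → f ≈ₚ (g *ₚ h) → IsUnitₚ g ⊎ IsUnitₚ h)

module ℤX = Poly ℤP.+-*-commutativeRing
module ℚX = Poly ℚP.+-*-commutativeRing

Matrix : ℕ → Set
Matrix n = Fin n → Fin n → ℕ

Bounded : (n H : ℕ) → Matrix n → Set
Bounded n H A = ∀ i j → A i j ℕ.≤ H

charPoly : (n : ℕ) → Matrix n → ℤX.P
charPoly n A = ℤX.det n (λ i j → entry i j)
  where
  entry : Fin n → Fin n → ℤX.P
  entry i j with i ≟ j
  ... | yes _ = ℤX.Xₚ ℤX.-ₚ ℤX.constₚ (ℤ.+ A i j)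
  ... | no  _ = ℤX.-ₚ ℤX.constₚ (ℤ.+ A i j)

toℚX : ℤX.P → ℚX.P
toℚX = map (λ z → z ℚ./ 1)

IrreducibleOverℚ : ℤX.P → Set
IrreducibleOverℚ f = ℚX.Irreducibleₚ (toℚX f)

InI : (n H : ℕ) → ℤX.P → Set
InI n H f = IrreducibleOverℚ f × Σ (Matrix n) (λ A → Bounded n H A × (charPoly n A ℤX.≈ₚ f))

AtLeast : (n H m : ℕ) → Set
AtLeast n H m = Σ (List ℤX.P) (λ fs →
  AllPairs (λ f g → ¬ (f ℤX.≈ₚ g)) fs × All (InI n H) fs × m ℕ.≤ length fs)

{-
Let n = 2m + 1. Take a digraph with vertices q₀ … q_{m-1}, v = p₀, p₁ … p_m, in this
order, with edges
  q_k → q_{k+1} (weight 1),  q_{m-1} → v (weight 2),  p_i → p_{i+1} (weight H),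
  p_i → q_k (weight d_{ik}),
where d_{mk} = 1 for k = 0 and 0 otherwise, and the d_{ik} with i < m are arbitrary in [0, H).
All cycles pass through v, so the characteristic polynomial of its weight matrix is
  Xⁿ − 2 Σ_{i ≤ m, k < m} Hⁱ d_{ik} X^{m-i+k}.
Since H is odd, its constant term −2 Hᵐ is not divisible by 4, and it is irreducible
by Eisenstein's criterion at 2. Reading the sum modulo H gives the row d₀, then d₁ after
cancelling it, and so on; so the H^(m²) choices of digits give different polynomials.
-}
module Submission where

open import Defs
open import Algebra.Bundles using (AbelianGroup; CommutativeRing)
open import Data.Nat as ℕ using (ℕ; zero; suc; s≤s; z≤n)
import Data.Nat.DivMod as ℕDM
import Data.Nat.Divisibility as ℕD
import Data.Nat.Properties as ℕP
open import Data.Nat.Induction using (<-rec)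
open import Data.Nat.Primality using (Prime; euclidsLemma; prime⇒nonZero; prime⇒nonTrivial; prime[2])
open import Data.Integer as ℤ using (ℤ; +_; 0ℤ; 1ℤ)
import Data.Integer.Properties as ℤP
open import Data.Integer.Divisibility.Signed
open import Data.Rational as ℚ using (ℚ; 0ℚ; 1ℚ; mkℚ; toℚᵘ)
import Data.Rational.Properties as ℚP
open import Data.Rational.Unnormalised as ℚᵘ using (mkℚᵘ; *≡*)
import Data.Rational.Unnormalised.Properties as ℚᵘP
open import Data.Fin using (Fin; zero; suc; toℕ; punchIn; _≟_)
import Data.Fin.Properties as FinP
open import Data.Vec using (Vec; []; _∷_)
import Data.Vec.Properties as VecP
open import Data.List as List using (List; []; _∷_; length; cartesianProductWith; allFin)
import Data.List.Properties as ListP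
open import Data.List.Relation.Unary.All as All using (All)
import Data.List.Relation.Unary.All.Properties as AllP
open import Data.List.Relation.Unary.AllPairs as AllPairs using (AllPairs; []; _∷_)
import Data.List.Relation.Unary.AllPairs.Properties as AllPairsP
open import Data.List.Relation.Unary.Unique.Propositional using (Unique)
import Data.List.Relation.Unary.Unique.Propositional.Properties as Unique
open import Data.Product using (Σ; _×_; _,_; ∃-syntax; proj₁)
open import Data.Sum as Sum using (_⊎_; inj₁; inj₂)
open import Function using (_∘_; id)
open import Relation.Binary.Definitions using (tri<; tri≈; tri>)
open import Relation.Nullary using (¬_; Dec; yes; no; contradiction)

-- Coefficients of products

module Convolution {c ℓ} (R : CommutativeRing c ℓ) where
  open CommutativeRing R
  open Poly R
  open import Algebra.Properties.Ring ring using (-0#≈0#)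
  open import Algebra.Properties.CommutativeSemigroup *-commutativeSemigroup using (interchange)
  open import Relation.Binary.Reasoning.Setoid setoid

  -- The Cauchy product on coefficient sequences. Sequences do not see trailing zeros, and peeling
  -- off `f 0` follows the recursion of `_*ₚ_`, so products are studied here rather than on lists.
  conv : (ℕ → Carrier) → (ℕ → Carrier) → ℕ → Carrier
  conv f g zero    = f 0 * g 0
  conv f g (suc k) = f 0 * g (suc k) + conv (f ∘ suc) g k

  conv-cong : ∀ {f f′ g g′} → (∀ k → f k ≈ f′ k) → (∀ k → g k ≈ g′ k) →
              ∀ k → conv f g k ≈ conv f′ g′ k
  conv-cong f≈ g≈ zero    = *-cong (f≈ 0) (g≈ 0)
  conv-cong f≈ g≈ (suc k) =
    +-cong (*-cong (f≈ 0) (g≈ (suc k))) (conv-cong (f≈ ∘ suc) g≈ k)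

  conv-zeroˡ : ∀ {f g} → (∀ k → f k ≈ 0#) → ∀ k → conv f g k ≈ 0#
  conv-zeroˡ f≈0 zero    = trans (*-congʳ (f≈0 0)) (zeroˡ _)
  conv-zeroˡ f≈0 (suc k) = trans
    (+-cong (trans (*-congʳ (f≈0 0)) (zeroˡ _)) (conv-zeroˡ (f≈0 ∘ suc) k))
    (+-identityˡ 0#)

  conv-zeroʳ : ∀ {f g} → (∀ k → g k ≈ 0#) → ∀ k → conv f g k ≈ 0#
  conv-zeroʳ g≈0 zero    = trans (*-congˡ (g≈0 0)) (zeroʳ _)
  conv-zeroʳ g≈0 (suc k) = trans
    (+-cong (trans (*-congˡ (g≈0 (suc k))) (zeroʳ _)) (conv-zeroʳ g≈0 k))
    (+-identityˡ 0#)

  conv-scale : ∀ a b f g k → conv (λ i → a * f i) (λ i → b * g i) k ≈ (a * b) * conv f g k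
  conv-scale a b f g zero    = interchange a (f 0) b (g 0)
  conv-scale a b f g (suc k) = trans
    (+-cong (interchange a (f 0) b (g (suc k))) (conv-scale a b (f ∘ suc) g k))
    (sym (distribˡ _ _ _))

  -- In every summand `f i * g j` with `i + j = a + b` other than `f a * g b`, one index exceeds its
  -- bound. With degrees as bounds this is the product of the leading coefficients.
  conv-top : ∀ {f g} a b → (∀ i → a ℕ.< i → f i ≈ 0#) → (∀ i → b ℕ.< i → g i ≈ 0#) →
             conv f g (a ℕ.+ b) ≈ f a * g b
  conv-top zero zero    f≈0 g≈0 = refl
  conv-top zero (suc b) f≈0 g≈0 =
    trans (+-congˡ (conv-zeroˡ (λ k → f≈0 (suc k) (s≤s z≤n)) b)) (+-identityʳ _)
  conv-top (suc a) b f≈0 g≈0 = trans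
    (+-cong (trans (*-congˡ (g≈0 (suc (a ℕ.+ b)) (s≤s (ℕP.m≤n+m b a)))) (zeroʳ _))
            (conv-top a b (λ i a<i → f≈0 (suc i) (s≤s a<i)) g≈0))
    (+-identityˡ _)

  coeff-+ : ∀ p q k → coeff (p +ₚ q) k ≈ coeff p k + coeff q k
  coeff-+ []      q       k       = sym (+-identityˡ _)
  coeff-+ (a ∷ p) []      k       = sym (+-identityʳ _)
  coeff-+ (a ∷ p) (b ∷ q) zero    = refl
  coeff-+ (a ∷ p) (b ∷ q) (suc k) = coeff-+ p q k

  coeff-neg : ∀ p k → coeff (-ₚ p) k ≈ - coeff p k
  coeff-neg []      k       = sym -0#≈0#
  coeff-neg (a ∷ p) zero    = refl
  coeff-neg (a ∷ p) (suc k) = coeff-neg p k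

  coeff-scale : ∀ a p k → coeff (scaleₚ a p) k ≈ a * coeff p k
  coeff-scale a []      k       = sym (zeroʳ a)
  coeff-scale a (b ∷ p) zero    = refl
  coeff-scale a (b ∷ p) (suc k) = coeff-scale a p k

  coeff-* : ∀ p q k → coeff (p *ₚ q) k ≈ conv (coeff p) (coeff q) k
  coeff-* []      q k = sym (conv-zeroˡ {coeff []} {coeff q} (λ _ → refl) k)
  coeff-* (a ∷ p) q zero = trans (coeff-+ (scaleₚ a q) _ 0)
    (trans (+-identityʳ _) (coeff-scale a q 0))
  coeff-* (a ∷ p) q (suc k) = trans (coeff-+ (scaleₚ a q) _ (suc k))
    (+-cong (coeff-scale a q (suc k)) (coeff-* p q k))

  conv-constˡ : ∀ a g k → conv (coeff (constₚ a)) g k ≈ a * g k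
  conv-constˡ a g zero    = refl
  conv-constˡ a g (suc k) =
    trans (+-congˡ (conv-zeroˡ {coeff []} {g} (λ _ → refl) k)) (+-identityʳ _)

  conv-Xˡ-suc : ∀ g k → conv (coeff Xₚ) g (suc k) ≈ g k
  conv-Xˡ-suc g k = trans (+-cong (zeroˡ _) (conv-constˡ 1# g k))
    (trans (+-identityˡ _) (*-identityˡ _))

  -- Lists may end in zeros, so their length gives no degree; a decision of equality with zero finds
  -- the last nonzero coefficient instead.
  zero-or-top : (∀ x → Dec (x ≈ 0#)) → ∀ p →
    (∀ i → coeff p i ≈ 0#) ⊎
    (∃[ d ] ¬ (coeff p d ≈ 0#) × (∀ i → d ℕ.< i → coeff p i ≈ 0#))
  zero-or-top _≟0 [] = inj₁ (λ _ → refl)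
  zero-or-top _≟0 (a ∷ p) with zero-or-top _≟0 p
  ... | inj₂ (d , nz , above) = inj₂ (suc d , nz , λ { (suc i) (s≤s d<i) → above i d<i })
  ... | inj₁ p≈0 with a ≟0
  ...   | yes a≈0 = inj₁ λ { zero → a≈0 ; (suc i) → p≈0 i }
  ...   | no  a≉0 = inj₂ (0 , a≉0 , λ { (suc i) _ → p≈0 i })

open import Data.Nat using (_≤_; _<_; _*_; _∸_; _^_; _%_; _/_)
open import Relation.Binary.PropositionalEquality

-- Eisenstein's criterion

open ℤX using (P; coeff; _≈ₚ_; _+ₚ_; _*ₚ_; -ₚ_; constₚ; Xₚ; oneₚ; signₚ; sumFin; det)
module ℤC = Convolution ℤP.+-*-commutativeRing

IsConstant : ℤX.P → Set
IsConstant g = ∀ i → 0 ℕ.< i → coeff g i ≡ 0ℤ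

module _ {p : ℕ} (p-prime : Prime p) where
  private instance
    p-nonZero = prime⇒nonZero p-prime

  p∣0 : + p ∣ 0ℤ
  p∣0 = ∣ᵤ⇒∣ (p ℕD.∣0)

  prime-∣-* : ∀ a b → + p ∣ a ℤ.* b → + p ∣ a ⊎ + p ∣ b
  prime-∣-* a b p∣ab
    with euclidsLemma ℤ.∣ a ∣ ℤ.∣ b ∣ p-prime (subst (p ℕD.∣_) (ℤP.abs-* a b) (∣⇒∣ᵤ p∣ab))
  ... | inj₁ p∣a = inj₁ (∣ᵤ⇒∣ p∣a)
  ... | inj₂ p∣b = inj₂ (∣ᵤ⇒∣ p∣b)

  -- The index `a` is the order of vanishing at 0 of `g` reduced modulo `p`. Phrasing it by
  -- divisibility avoids polynomials over the residue field.
  divisible-or-lowest : ∀ g → (∀ i → + p ∣ coeff g i) ⊎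
    (∃[ a ] (∀ i → i ℕ.< a → + p ∣ coeff g i) × ¬ (+ p ∣ coeff g a))
  divisible-or-lowest [] = inj₁ (λ _ → p∣0)
  divisible-or-lowest (x ∷ g) with + p ∣? x
  ... | no  p∤x = inj₂ (0 , (λ _ ()) , p∤x)
  ... | yes p∣x with divisible-or-lowest g
  ...   | inj₁ p∣g = inj₁ λ { zero → p∣x ; (suc i) → p∣g i }
  ...   | inj₂ (a , below , p∤a) =
    inj₂ (suc a , (λ { zero _ → p∣x ; (suc i) (s≤s i<a) → below i i<a }) , p∤a)

  quotient-poly : ∀ g → (∀ i → + p ∣ coeff g i) →
    Σ ℤX.P λ g′ → ∀ i → coeff g i ≡ + p ℤ.* coeff g′ i
  quotient-poly [] _ = [] , λ _ → sym (ℤP.*-zeroʳ (+ p))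
  quotient-poly (x ∷ g) p∣ with p∣ 0 | quotient-poly g (p∣ ∘ suc)
  ... | divides q x≡qp | g′ , g≡pg′ =
    q ∷ g′ , λ { zero → trans x≡qp (ℤP.*-comm q (+ p)) ; (suc i) → g≡pg′ i }

  conv-divisibleʳ : ∀ f {g} k → (∀ j → j ℕ.≤ k → + p ∣ g j) → + p ∣ ℤC.conv f g k
  conv-divisibleʳ f zero    p∣g = ∣n⇒∣m*n (f 0) (p∣g 0 z≤n)
  conv-divisibleʳ f (suc k) p∣g = ∣m∣n⇒∣m+n (∣n⇒∣m*n (f 0) (p∣g (suc k) ℕP.≤-refl))
    (conv-divisibleʳ (f ∘ suc) k (λ j j≤k → p∣g j (ℕP.m≤n⇒m≤1+n j≤k)))

  conv-divisibleˡ : ∀ {f} g k → (∀ i → + p ∣ f i) → + p ∣ ℤC.conv f g k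
  conv-divisibleˡ g zero    p∣f = ∣m⇒∣m*n (g 0) (p∣f 0)
  conv-divisibleˡ g (suc k) p∣f =
    ∣m∣n⇒∣m+n (∣m⇒∣m*n (g (suc k)) (p∣f 0)) (conv-divisibleˡ g k (p∣f ∘ suc))

  -- Each summand of the coefficient at `a + b` other than `f a * g b` has an index below `a` or
  -- below `b`, hence a factor divisible by `p`.
  conv-lowest : ∀ {f g} a b → (∀ i → i ℕ.< a → + p ∣ f i) → (∀ j → j ℕ.< b → + p ∣ g j) →
    + p ∣ ℤC.conv f g (a ℕ.+ b) → + p ∣ f a ℤ.* g b
  conv-lowest zero zero    p∣f p∣g p∣fg = p∣fg
  conv-lowest {f} zero (suc b) p∣f p∣g p∣fg =
    ∣m+n∣n⇒∣m p∣fg (conv-divisibleʳ (f ∘ suc) b (λ j j≤b → p∣g j (s≤s j≤b)))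
  conv-lowest {f} {g} (suc a) b p∣f p∣g p∣fg =
    conv-lowest a b (λ i i<a → p∣f (suc i) (s≤s i<a)) p∣g
      (∣m+n∣m⇒∣n p∣fg (∣m⇒∣m*n (g (suc (a ℕ.+ b))) (p∣f 0 (s≤s z≤n))))

  module _ {f : ℤX.P} {n : ℕ} (0<n : 0 ℕ.< n)
    (p∣f : ∀ i → i ℕ.< n → + p ∣ coeff f i) (p∤fₙ : ¬ (+ p ∣ coeff f n))
    (f-above : ∀ i → n ℕ.< i → coeff f i ≡ 0ℤ) (p²∤f₀ : ¬ (+ (p ℕ.* p) ∣ coeff f 0)) where

    private
      -- A rational factorisation becomes integral only up to a multiple `K`, the product of the
      -- cleared denominators, so `K` is carried along.
      ProductOf : ℕ → ℤX.P → ℤX.P → Set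
      ProductOf K g h = ∀ k → + K ℤ.* coeff f k ≡ ℤC.conv (coeff g) (coeff h) k

      +p*+p : + p ℤ.* + p ≡ + (p ℕ.* p)
      +p*+p = sym (ℤP.pos-* p p)

      cancel-p : ∀ {x y} → + p ℤ.* x ≡ + p ℤ.* y → x ≡ y
      cancel-p {x} {y} = ℤP.*-cancelˡ-≡ (+ p) x y

      -- Otherwise `p²` divides `K f₀`. With `f₀ = c p`, cancelling one `p` shows that `p` divides
      -- `K c`, hence `c`, and then `p²` divides `f₀`.
      not-both-divisible₀ : ∀ {K g h} → ¬ (+ p ∣ + K) → ProductOf K g h →
        ¬ (+ p ∣ coeff g 0 × + p ∣ coeff h 0)
      not-both-divisible₀ {K} {g} {h} p∤K K*f≡gh (divides a g₀≡ap , divides b h₀≡bp)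
        with p∣f 0 0<n
      ... | divides c f₀≡cp with prime-∣-* (+ K) c p∣Kc
        where
        open ≡-Reasoning
        p∣Kc : + p ∣ + K ℤ.* c
        p∣Kc = divides (a ℤ.* b) (cancel-p (begin
          + p ℤ.* (+ K ℤ.* c)           ≡⟨ ℤP.*-comm (+ p) _ ⟩
          + K ℤ.* c ℤ.* + p             ≡⟨ ℤP.*-assoc (+ K) c (+ p) ⟩
          + K ℤ.* (c ℤ.* + p)           ≡⟨ cong (+ K ℤ.*_) f₀≡cp ⟨
          + K ℤ.* coeff f 0             ≡⟨ K*f≡gh 0 ⟩
          coeff g 0 ℤ.* coeff h 0       ≡⟨ cong₂ ℤ._*_ g₀≡ap h₀≡bp ⟩
          a ℤ.* + p ℤ.* (b ℤ.* + p)     ≡⟨ interchange a (+ p) b (+ p) ⟩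
          a ℤ.* b ℤ.* (+ p ℤ.* + p)     ≡⟨ ℤP.*-assoc (a ℤ.* b) (+ p) (+ p) ⟨
          a ℤ.* b ℤ.* + p ℤ.* + p       ≡⟨ ℤP.*-comm (a ℤ.* b ℤ.* + p) (+ p) ⟩
          + p ℤ.* (a ℤ.* b ℤ.* + p)     ∎))
          where open import Algebra.Properties.CommutativeSemigroup ℤP.*-commutativeSemigroup using (interchange)
      ...   | inj₁ p∣K = p∤K p∣K
      ...   | inj₂ (divides d c≡dp) = p²∤f₀ (divides d (trans f₀≡cp
                (trans (cong (ℤ._* + p) c≡dp) (trans (ℤP.*-assoc d (+ p) (+ p)) (cong (d ℤ.*_) +p*+p)))))

      -- Modulo p the product is a multiple of Xⁿ, so the lowest coefficients of
      -- g and h that survive modulo p are also their leading ones.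
      primitive-case : ∀ K g h → ¬ (+ p ∣ + K) → ProductOf K g h →
        IsConstant g ⊎ IsConstant h
      primitive-case K g h p∤K K*f≡gh = result
        where
        Kf : ℕ → ℤ
        Kf i = + K ℤ.* coeff f i

        p∤Kfₙ : ¬ (+ p ∣ Kf n)
        p∤Kfₙ p∣ with prime-∣-* (+ K) (coeff f n) p∣
        ... | inj₁ p∣K  = p∤K p∣K
        ... | inj₂ p∣fₙ = p∤fₙ p∣fₙ

        Kf-above : ∀ i → n ℕ.< i → Kf i ≡ 0ℤ
        Kf-above i n<i = trans (cong (+ K ℤ.*_) (f-above i n<i)) (ℤP.*-zeroʳ (+ K))

        p∣Kf : ∀ i → i ≢ n → + p ∣ Kf i
        p∣Kf i i≢n with ℕP.<-cmp i n
        ... | tri< i<n _ _ = ∣n⇒∣m*n (+ K) (p∣f i i<n)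
        ... | tri≈ _ i≡n _ = contradiction i≡n i≢n
        ... | tri> _ _ n<i = subst (+ p ∣_) (sym (Kf-above i n<i)) p∣0

        p∤gh : ¬ (∀ k → + p ∣ ℤC.conv (coeff g) (coeff h) k)
        p∤gh p∣gh = p∤Kfₙ (subst (+ p ∣_) (sym (K*f≡gh n)) (p∣gh n))

        constant-below-top : ∀ {a d} (q : ℤX.P) → a ≡ 0 → d ℕ.≤ a →
          (∀ i → d ℕ.< i → coeff q i ≡ 0ℤ) → IsConstant q
        constant-below-top q refl z≤n above = above

        result : IsConstant g ⊎ IsConstant h
        result with divisible-or-lowest g | divisible-or-lowest h
                  | ℤC.zero-or-top (ℤ._≟ 0ℤ) g | ℤC.zero-or-top (ℤ._≟ 0ℤ) h
        ... | inj₁ p∣g | _ | _ | _ = contradiction (λ k → conv-divisibleˡ (coeff h) k p∣g) p∤gh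
        ... | inj₂ _ | inj₁ p∣h | _ | _ =
          contradiction (λ k → conv-divisibleʳ (coeff g) k (λ j _ → p∣h j)) p∤gh
        -- `IsConstant` includes the zero polynomial, which settles the cases without a top
        -- coefficient.
        ... | inj₂ _ | inj₂ _ | inj₁ g≡0 | _ =
          inj₁ (λ i _ → g≡0 i)
        ... | inj₂ _ | inj₂ _ | inj₂ _ | inj₁ h≡0 =
          inj₂ (λ i _ → h≡0 i)
        ... | inj₂ (a , p∣g , p∤gₐ) | inj₂ (b , p∣h , p∤h_b)
            | inj₂ (d , g_d≢0 , g-above) | inj₂ (e , h_e≢0 , h-above) = conclude a b d≤a e≤b
              p∣g p∣h
          where
          -- By `conv-lowest`, `p` does not divide the coefficient at `a + b`, and `n` is the only
          -- index at which `K f` is not divisible by `p`.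
          a+b≡n : a ℕ.+ b ≡ n
          a+b≡n with a ℕ.+ b ℕ.≟ n
          ... | yes eq = eq
          ... | no  ne with prime-∣-* (coeff g a) (coeff h b)
                 (conv-lowest a b p∣g p∣h (subst (+ p ∣_) (K*f≡gh (a ℕ.+ b)) (p∣Kf _ ne)))
          ...   | inj₁ p∣gₐ  = contradiction p∣gₐ p∤gₐ
          ...   | inj₂ p∣h_b = contradiction p∣h_b p∤h_b

          d+e≤n : d ℕ.+ e ℕ.≤ n
          d+e≤n = ℕP.≮⇒≥ λ n<d+e → go (ℤP.i*j≡0⇒i≡0∨j≡0 (coeff g d)
            (trans (sym (ℤC.conv-top d e g-above h-above))
              (trans (sym (K*f≡gh (d ℕ.+ e))) (Kf-above _ n<d+e))))
            where
            go : ¬ (coeff g d ≡ 0ℤ ⊎ coeff h e ≡ 0ℤ)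
            go (inj₁ g_d≡0) = g_d≢0 g_d≡0
            go (inj₂ h_e≡0) = h_e≢0 h_e≡0

          below-top : ∀ {q c t} → ¬ (+ p ∣ coeff q c) → (∀ i → t ℕ.< i → coeff q i ≡ 0ℤ) → c ℕ.≤ t
          below-top p∤ above = ℕP.≮⇒≥ λ t<c → p∤ (subst (+ p ∣_) (sym (above _ t<c)) p∣0)

          a≤d : a ℕ.≤ d
          a≤d = below-top {g} p∤gₐ g-above

          b≤e : b ℕ.≤ e
          b≤e = below-top {h} p∤h_b h-above

          d+e≤a+b : d ℕ.+ e ℕ.≤ a ℕ.+ b
          d+e≤a+b = subst (d ℕ.+ e ℕ.≤_) (sym a+b≡n) d+e≤n

          d≤a : d ℕ.≤ a
          d≤a = ℕP.+-cancelʳ-≤ e d a (ℕP.≤-trans d+e≤a+b (ℕP.+-monoʳ-≤ a b≤e))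

          e≤b : e ℕ.≤ b
          e≤b = ℕP.+-cancelˡ-≤ d e b (ℕP.≤-trans d+e≤a+b (ℕP.+-monoˡ-≤ b a≤d))

          -- At this point `a = d` and `b = e`. If one of them is 0, that factor is constant; if
          -- both are positive, `p` divides both constant terms.
          conclude : ∀ a b → d ℕ.≤ a → e ℕ.≤ b → (∀ i → i ℕ.< a → + p ∣ coeff g i) →
            (∀ i → i ℕ.< b → + p ∣ coeff h i) → IsConstant g ⊎ IsConstant h
          conclude zero _ d≤0 _ _ _ = inj₁ (constant-below-top g refl d≤0 g-above)
          conclude (suc _) zero _ e≤0 _ _ = inj₂ (constant-below-top h refl e≤0 h-above)
          conclude (suc _) (suc _) _ _ p∣g p∣h = contradiction
            (p∣g 0 (s≤s z≤n) , p∣h 0 (s≤s z≤n)) (not-both-divisible₀ {K} {g} {h} p∤K K*f≡gh)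

    -- Gauss's lemma is absorbed in the multiple K: while p divides K, one of
    -- the factors is divisible by p and can be divided by it.
    eisenstein-ℤ : ∀ K → K ≢ 0 → ∀ g h → ProductOf K g h → IsConstant g ⊎ IsConstant h
    eisenstein-ℤ = <-rec _ step
      where
      step : ∀ K → (∀ {K′} → K′ ℕ.< K → K′ ≢ 0 → ∀ g h → ProductOf K′ g h → IsConstant g ⊎ IsConstant h) →
             K ≢ 0 → ∀ g h → ProductOf K g h → IsConstant g ⊎ IsConstant h
      step K rec K≢0 g h K*f≡gh with + p ∣? + K
      ... | no p∤K = primitive-case K g h p∤K K*f≡gh
      ... | yes p∣K with ∣⇒∣ᵤ p∣K
      ...   | ℕD.divides K′ refl = divide (divisible-or-lowest g) (divisible-or-lowest h)
        where
        K′≢0 : K′ ≢ 0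
        K′≢0 refl = K≢0 refl

        K′<K : K′ ℕ.< K′ ℕ.* p
        K′<K = ℕP.m<m*n K′ p {{ℕ.≢-nonZero K′≢0}} (ℕ.nonTrivial⇒n>1 p {{prime⇒nonTrivial p-prime}})

        p*K′f : ∀ k → + p ℤ.* (+ K′ ℤ.* coeff f k) ≡ + (K′ ℕ.* p) ℤ.* coeff f k
        p*K′f k = trans (sym (ℤP.*-assoc (+ p) (+ K′) _))
          (cong (ℤ._* coeff f k) (trans (ℤP.*-comm (+ p) (+ K′)) (sym (ℤP.pos-* K′ p))))

        p∣gh : ∀ k → + p ∣ ℤC.conv (coeff g) (coeff h) k
        p∣gh k = subst (+ p ∣_) (trans (p*K′f k) (K*f≡gh k)) (∣m⇒∣m*n _ ∣-refl)

        scaled : ∀ {q q′} → (∀ i → coeff q i ≡ + p ℤ.* coeff q′ i) → IsConstant q′ → IsConstant q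
        scaled q≡ q′-const i 0<i =
          trans (q≡ i) (trans (cong (+ p ℤ.*_) (q′-const i 0<i)) (ℤP.*-zeroʳ (+ p)))

        -- `conv-scale` scales both factors, so the undivided one receives the scalar 1.
        one* : ∀ (u : ℕ → ℤ) k → u k ≡ ℤ.1ℤ ℤ.* u k
        one* u k = sym (ℤP.*-identityˡ (u k))

        divide : _ → _ → IsConstant g ⊎ IsConstant h
        divide (inj₁ p∣g) _ with quotient-poly g p∣g
        ... | g′ , g≡pg′ with rec K′<K K′≢0 g′ h (λ k → cancel-p (trans (p*K′f k) (trans (K*f≡gh k)
                (trans (ℤC.conv-cong g≡pg′ (one* (coeff h)) k)
                (trans (ℤC.conv-scale (+ p) ℤ.1ℤ (coeff g′) (coeff h) k)
                       (cong (ℤ._* ℤC.conv (coeff g′) (coeff h) k) (ℤP.*-identityʳ (+ p))))))))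
        ...   | inj₁ g′-const = inj₁ (scaled {g} {g′} g≡pg′ g′-const)
        ...   | inj₂ h-const  = inj₂ h-const
        divide (inj₂ _) (inj₁ p∣h) with quotient-poly h p∣h
        ... | h′ , h≡ph′ with rec K′<K K′≢0 g h′ (λ k → cancel-p (trans (p*K′f k) (trans (K*f≡gh k)
                (trans (ℤC.conv-cong (one* (coeff g)) h≡ph′ k)
                (trans (ℤC.conv-scale ℤ.1ℤ (+ p) (coeff g) (coeff h′) k)
                       (cong (ℤ._* ℤC.conv (coeff g) (coeff h′) k) (ℤP.*-identityˡ (+ p))))))))
        ...   | inj₁ g-const  = inj₁ g-const
        ...   | inj₂ h′-const = inj₂ (scaled {h} {h′} h≡ph′ h′-const)
        -- Gauss's lemma: both factors survive modulo `p`, yet `p` divides every coefficient of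
        -- their product, in particular the one at `a + b`.
        divide (inj₂ (a , p∣g , p∤gₐ)) (inj₂ (b , p∣h , p∤h_b))
          with prime-∣-* (coeff g a) (coeff h b) (conv-lowest a b p∣g p∣h (p∣gh (a ℕ.+ b)))
        ... | inj₁ p∣gₐ  = contradiction p∣gₐ p∤gₐ
        ... | inj₂ p∣h_b = contradiction p∣h_b p∤h_b

-- Rational factors and cleared denominators

module ℚC = Convolution ℚP.+-*-commutativeRing

ι : ℤ → ℚ
ι z = z ℚ./ 1

-- `ι` normalises by a gcd and does not compute on variables. Identities for it are checked among
-- unnormalised rationals, where they reduce to integer arithmetic.
toℚᵘ-ι : ∀ z → toℚᵘ (ι z) ℚᵘ.≃ mkℚᵘ z 0
toℚᵘ-ι z = ℚP.toℚᵘ-fromℚᵘ (mkℚᵘ z 0)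

ι-injective : ∀ {x y} → ι x ≡ ι y → x ≡ y
ι-injective {x} {y} eq with ℚP.fromℚᵘ-injective {mkℚᵘ x 0} {mkℚᵘ y 0} eq
... | *≡* eq′ = ℤP.*-cancelʳ-≡ x y (+ 1) eq′

ι-+ : ∀ x y → ι (x ℤ.+ y) ≡ ι x ℚ.+ ι y
ι-+ x y = ℚP.toℚᵘ-injective (begin
  toℚᵘ (ι (x ℤ.+ y))           ≈⟨ toℚᵘ-ι (x ℤ.+ y) ⟩
  mkℚᵘ (x ℤ.+ y) 0             ≈⟨ *≡* (cong (ℤ._* + 1) (cong₂ ℤ._+_ (sym (ℤP.*-identityʳ x)) (sym (ℤP.*-identityʳ y)))) ⟩
  mkℚᵘ x 0 ℚᵘ.+ mkℚᵘ y 0       ≈⟨ ℚᵘP.+-cong (toℚᵘ-ι x) (toℚᵘ-ι y) ⟨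
  toℚᵘ (ι x) ℚᵘ.+ toℚᵘ (ι y)   ≈⟨ ℚP.toℚᵘ-homo-+ (ι x) (ι y) ⟨
  toℚᵘ (ι x ℚ.+ ι y)           ∎)
  where open import Relation.Binary.Reasoning.Setoid ℚᵘP.≃-setoid

ι-* : ∀ x y → ι (x ℤ.* y) ≡ ι x ℚ.* ι y
ι-* x y = ℚP.toℚᵘ-injective (begin
  toℚᵘ (ι (x ℤ.* y))           ≈⟨ toℚᵘ-ι (x ℤ.* y) ⟩
  mkℚᵘ x 0 ℚᵘ.* mkℚᵘ y 0       ≈⟨ ℚᵘP.*-cong (toℚᵘ-ι x) (toℚᵘ-ι y) ⟨
  toℚᵘ (ι x) ℚᵘ.* toℚᵘ (ι y)   ≈⟨ ℚP.toℚᵘ-homo-* (ι x) (ι y) ⟨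
  toℚᵘ (ι x ℚ.* ι y)           ∎)
  where open import Relation.Binary.Reasoning.Setoid ℚᵘP.≃-setoid

denominator-* : ∀ x → ι (ℚ.↧ x) ℚ.* x ≡ ι (ℚ.↥ x)
denominator-* x@(mkℚ n d-1 _) = ℚP.toℚᵘ-injective (begin
  toℚᵘ (ι (ℚ.↧ x) ℚ.* x)             ≈⟨ ℚP.toℚᵘ-homo-* (ι (ℚ.↧ x)) x ⟩
  toℚᵘ (ι (ℚ.↧ x)) ℚᵘ.* toℚᵘ x       ≈⟨ ℚᵘP.*-congʳ (toℚᵘ-ι (ℚ.↧ x)) ⟩
  mkℚᵘ (ℚ.↧ x) 0 ℚᵘ.* toℚᵘ x         ≈⟨ *≡* eq ⟩
  mkℚᵘ n 0                           ≈⟨ toℚᵘ-ι n ⟨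
  toℚᵘ (ι n)                         ∎)
  where
  open import Relation.Binary.Reasoning.Setoid ℚᵘP.≃-setoid
  eq : (+ suc d-1 ℤ.* n) ℤ.* + 1 ≡ n ℤ.* + (1 ℕ.* suc d-1)
  eq = trans (ℤP.*-identityʳ _) (trans (ℤP.*-comm (+ suc d-1) n)
    (cong (λ k → n ℤ.* + k) (sym (ℕP.*-identityˡ (suc d-1)))))

ι-nonZero : ∀ {N} → N ≢ 0 → ι (+ N) ≢ 0ℚ
ι-nonZero N≢0 ιN≡0 = N≢0 (ℤP.+-injective (ι-injective ιN≡0))

no-zero-divisors : ∀ {x y} → x ≢ 0ℚ → x ℚ.* y ≡ 0ℚ → y ≡ 0ℚ
no-zero-divisors {x} {y} x≢0 xy≡0 = begin
  y                       ≡⟨ ℚP.*-identityˡ y ⟨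
  1ℚ ℚ.* y                ≡⟨ cong (ℚ._* y) (ℚP.*-inverseˡ x) ⟨
  ℚ.1/ x ℚ.* x ℚ.* y      ≡⟨ ℚP.*-assoc (ℚ.1/ x) x y ⟩
  ℚ.1/ x ℚ.* (x ℚ.* y)    ≡⟨ cong (ℚ.1/ x ℚ.*_) xy≡0 ⟩
  ℚ.1/ x ℚ.* 0ℚ           ≡⟨ ℚP.*-zeroʳ (ℚ.1/ x) ⟩
  0ℚ                      ∎
  where
  open ≡-Reasoning
  instance _ = ℚ.≢-nonZero x≢0

coeff-toℚX : ∀ p k → ℚX.coeff (toℚX p) k ≡ ι (coeff p k)
coeff-toℚX []      k       = refl
coeff-toℚX (a ∷ p) zero    = refl
coeff-toℚX (a ∷ p) (suc k) = coeff-toℚX p k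

ι-conv : ∀ f g k → ι (ℤC.conv f g k) ≡ ℚC.conv (ι ∘ f) (ι ∘ g) k
ι-conv f g zero    = ι-* (f 0) (g 0)
ι-conv f g (suc k) = trans (ι-+ (f 0 ℤ.* g (suc k)) _)
  (cong₂ ℚ._+_ (ι-* (f 0) (g (suc k))) (ι-conv (f ∘ suc) g k))

-- `N` is the product of all denominators: a new coefficient `x` with denominator `d` is multiplied
-- by the old `N` as well, and the integral tail found so far by `d`.
clear-denominators : ∀ g → ∃[ N ] N ≢ 0 ×
  Σ ℤX.P λ g′ → ∀ k → ι (+ N) ℚ.* ℚX.coeff g k ≡ ι (coeff g′ k)
clear-denominators [] = 1 , (λ ()) , [] , λ k → ℚP.*-zeroʳ (ι (+ 1))
clear-denominators (x ∷ g) with clear-denominators g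
... | N , N≢0 , g′ , Ng≡g′ = N ℕ.* d , Nd≢0 , (+ N ℤ.* ℚ.↥ x) ∷ ℤX.scaleₚ (+ d) g′ ,
  λ { zero → head ; (suc k) → tail k }
  where
  open ≡-Reasoning
  d = ℚ.↧ₙ x
  instance _ = ℕ.≢-nonZero N≢0

  Nd≢0 : N ℕ.* d ≢ 0
  Nd≢0 = ℕ.≢-nonZero⁻¹ (N ℕ.* d) {{ℕP.m*n≢0 N d}}

  ιNd : ι (+ (N ℕ.* d)) ≡ ι (+ N) ℚ.* ι (+ d)
  ιNd = trans (cong ι (ℤP.pos-* N d)) (ι-* (+ N) (+ d))

  head : ι (+ (N ℕ.* d)) ℚ.* x ≡ ι (+ N ℤ.* ℚ.↥ x)
  head = begin
    ι (+ (N ℕ.* d)) ℚ.* x         ≡⟨ cong (ℚ._* x) ιNd ⟩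
    ι (+ N) ℚ.* ι (+ d) ℚ.* x     ≡⟨ ℚP.*-assoc (ι (+ N)) (ι (+ d)) x ⟩
    ι (+ N) ℚ.* (ι (+ d) ℚ.* x)   ≡⟨ cong (ι (+ N) ℚ.*_) (denominator-* x) ⟩
    ι (+ N) ℚ.* ι (ℚ.↥ x)         ≡⟨ ι-* (+ N) (ℚ.↥ x) ⟨
    ι (+ N ℤ.* ℚ.↥ x)             ∎

  tail : ∀ k → ι (+ (N ℕ.* d)) ℚ.* ℚX.coeff g k ≡ ι (coeff (ℤX.scaleₚ (+ d) g′) k)
  tail k = begin
    ι (+ (N ℕ.* d)) ℚ.* ℚX.coeff g k         ≡⟨ cong (ℚ._* _) (trans ιNd (ℚP.*-comm (ι (+ N)) (ι (+ d)))) ⟩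
    ι (+ d) ℚ.* ι (+ N) ℚ.* ℚX.coeff g k     ≡⟨ ℚP.*-assoc (ι (+ d)) (ι (+ N)) _ ⟩
    ι (+ d) ℚ.* (ι (+ N) ℚ.* ℚX.coeff g k)   ≡⟨ cong (ι (+ d) ℚ.*_) (Ng≡g′ k) ⟩
    ι (+ d) ℚ.* ι (coeff g′ k)               ≡⟨ ι-* (+ d) (coeff g′ k) ⟨
    ι (+ d ℤ.* coeff g′ k)                   ≡⟨ cong ι (ℤC.coeff-scale (+ d) g′ k) ⟨
    ι (coeff (ℤX.scaleₚ (+ d) g′) k)         ∎

constant-unit : ∀ (g : ℚX.P) → ¬ (∀ k → ℚX.coeff g k ≡ 0ℚ) →
  (∀ k → 0 ℕ.< k → ℚX.coeff g k ≡ 0ℚ) → ℚX.IsUnitₚ g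
constant-unit g g≢0 g-const = ℚX.constₚ (ℚ.1/ g₀) ,
  λ k → trans (ℚC.coeff-* g (ℚX.constₚ (ℚ.1/ g₀)) k) (gu≈1 k)
  where
  g₀ = ℚX.coeff g 0

  g₀≢0 : g₀ ≢ 0ℚ
  g₀≢0 g₀≡0 = g≢0 λ { zero → g₀≡0 ; (suc k) → g-const (suc k) (s≤s z≤n) }

  instance _ = ℚ.≢-nonZero g₀≢0

  coeff-const : ∀ k → ℚX.coeff g k ≡ ℚX.coeff (ℚX.constₚ g₀) k
  coeff-const zero    = refl
  coeff-const (suc k) = g-const (suc k) (s≤s z≤n)

  gu≈1 : ∀ k → ℚC.conv (ℚX.coeff g) (ℚX.coeff (ℚX.constₚ (ℚ.1/ g₀))) k ≡ ℚX.coeff ℚX.oneₚ k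
  gu≈1 k = trans (ℚC.conv-cong coeff-const (λ _ → refl) k)
    (trans (ℚC.conv-constˡ g₀ _ k) (one k))
    where
    one : ∀ k → g₀ ℚ.* ℚX.coeff (ℚX.constₚ (ℚ.1/ g₀)) k ≡ ℚX.coeff ℚX.oneₚ k
    one zero    = ℚP.*-inverseʳ g₀
    one (suc k) = ℚP.*-zeroʳ g₀

eisenstein : ∀ {p n} (f : ℤX.P) → Prime p → 0 ℕ.< n →
  (∀ i → i ℕ.< n → + p ∣ coeff f i) → ¬ (+ p ∣ coeff f n) →
  (∀ i → n ℕ.< i → coeff f i ≡ 0ℤ) → ¬ (+ (p ℕ.* p) ∣ coeff f 0) →
  IrreducibleOverℚ f
eisenstein {p} {n} f p-prime 0<n p∣f p∤fₙ f-above p²∤f₀ = nonzero , nonunit , factors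
  where
  F = ℚX.coeff (toℚX f)

  fₙ≢0 : coeff f n ≢ 0ℤ
  fₙ≢0 fₙ≡0 = p∤fₙ (subst (+ p ∣_) (sym fₙ≡0) (p∣0 p-prime))

  Fₙ≢0 : F n ≢ 0ℚ
  Fₙ≢0 Fₙ≡0 = fₙ≢0 (ι-injective (trans (sym (coeff-toℚX f n)) Fₙ≡0))

  F-above : ∀ i → n ℕ.< i → F i ≡ 0ℚ
  F-above i n<i = trans (coeff-toℚX f i) (cong ι (f-above i n<i))

  nonzero : ¬ (toℚX f ℚX.≈ₚ ℚX.zeroₚ)
  nonzero f≈0 = Fₙ≢0 (f≈0 n)

  one-above : ∀ {k} → 0 ℕ.< k → ℚX.coeff ℚX.oneₚ k ≡ 0ℚ
  one-above (s≤s _) = refl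

  nonunit : ¬ ℚX.IsUnitₚ (toℚX f)
  nonunit (u , fu≈1) with ℚC.zero-or-top (ℚ._≟ 0ℚ) u
  ... | inj₁ u≡0 = contradiction
    (trans (sym (fu≈1 0)) (trans (ℚC.coeff-* (toℚX f) u 0) (ℚC.conv-zeroʳ {F} u≡0 0))) λ ()
  -- The top coefficient of `f u` stands at `n + d`, which is positive, so comparison with `oneₚ`
  -- makes it zero.
  ... | inj₂ (d , u_d≢0 , u-above) = u_d≢0 (no-zero-divisors Fₙ≢0
    (trans (sym (ℚC.conv-top n d F-above u-above))
    (trans (sym (ℚC.coeff-* (toℚX f) u (n ℕ.+ d)))
    (trans (fu≈1 (n ℕ.+ d)) (one-above (ℕP.≤-trans 0<n (ℕP.m≤m+n n d)))))))

  factors : ∀ g h → toℚX f ℚX.≈ₚ (g ℚX.*ₚ h) → ℚX.IsUnitₚ g ⊎ ℚX.IsUnitₚ h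
  factors g h f≈gh with clear-denominators g | clear-denominators h
  ... | N , N≢0 , g′ , Ng≡g′ | M , M≢0 , h′ , Mh≡h′ =
    -- Since `N g = g′` with `N ≢ 0`, constancy passes from `g′` back to `g`, and a nonzero rational
    -- constant is a unit; likewise for `h`.
    Sum.map (unit g g′ N≢0 Ng≡g′ g≢0) (unit h h′ M≢0 Mh≡h′ h≢0)
      (eisenstein-ℤ p-prime {f} 0<n p∣f p∤fₙ f-above p²∤f₀ (N ℕ.* M) NM≢0 g′ h′ NMf≡g′h′)
    where
    open ≡-Reasoning
    instance
      _ = ℕ.≢-nonZero N≢0
      _ = ℕ.≢-nonZero M≢0

    F≡conv : ∀ k → F k ≡ ℚC.conv (ℚX.coeff g) (ℚX.coeff h) k
    F≡conv k = trans (f≈gh k) (ℚC.coeff-* g h k)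

    g≢0 : ¬ (∀ k → ℚX.coeff g k ≡ 0ℚ)
    g≢0 g≡0 = Fₙ≢0 (trans (F≡conv n) (ℚC.conv-zeroˡ g≡0 n))

    h≢0 : ¬ (∀ k → ℚX.coeff h k ≡ 0ℚ)
    h≢0 h≡0 = Fₙ≢0 (trans (F≡conv n) (ℚC.conv-zeroʳ {ℚX.coeff g} h≡0 n))

    unit : ∀ {K} q q′ → K ≢ 0 → (∀ k → ι (+ K) ℚ.* ℚX.coeff q k ≡ ι (coeff q′ k)) →
      ¬ (∀ k → ℚX.coeff q k ≡ 0ℚ) → IsConstant q′ → ℚX.IsUnitₚ q
    unit q q′ K≢0 Kq≡q′ q≢0 q′-const = constant-unit q q≢0 λ k 0<k →
      no-zero-divisors (ι-nonZero K≢0) (trans (Kq≡q′ k) (cong ι (q′-const k 0<k)))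

    NM≢0 : N ℕ.* M ≢ 0
    NM≢0 = ℕ.≢-nonZero⁻¹ (N ℕ.* M) {{ℕP.m*n≢0 N M}}

    NMf≡g′h′ : ∀ k → + (N ℕ.* M) ℤ.* coeff f k ≡ ℤC.conv (coeff g′) (coeff h′) k
    NMf≡g′h′ k = ι-injective (begin
      ι (+ (N ℕ.* M) ℤ.* coeff f k)               ≡⟨ ι-* (+ (N ℕ.* M)) (coeff f k) ⟩
      ι (+ (N ℕ.* M)) ℚ.* ι (coeff f k)           ≡⟨ cong₂ ℚ._*_ (trans (cong ι (ℤP.pos-* N M)) (ι-* (+ N) (+ M))) (sym (coeff-toℚX f k)) ⟩
      ι (+ N) ℚ.* ι (+ M) ℚ.* F k                 ≡⟨ cong (ι (+ N) ℚ.* ι (+ M) ℚ.*_) (F≡conv k) ⟩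
      ι (+ N) ℚ.* ι (+ M) ℚ.* ℚC.conv (ℚX.coeff g) (ℚX.coeff h) k
                                                  ≡⟨ ℚC.conv-scale (ι (+ N)) (ι (+ M)) (ℚX.coeff g) (ℚX.coeff h) k ⟨
      ℚC.conv (λ i → ι (+ N) ℚ.* ℚX.coeff g i) (λ i → ι (+ M) ℚ.* ℚX.coeff h i) k
                                                  ≡⟨ ℚC.conv-cong Ng≡g′ Mh≡h′ k ⟩
      ℚC.conv (ι ∘ coeff g′) (ι ∘ coeff h′) k     ≡⟨ ι-conv (coeff g′) (coeff h′) k ⟨
      ι (ℤC.conv (coeff g′) (coeff h′) k)         ∎)

-- Characteristic polynomials of bordered matrices

+ₚ-cong : ∀ p p′ q q′ → p ≈ₚ p′ → q ≈ₚ q′ → (p +ₚ q) ≈ₚ (p′ +ₚ q′)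
+ₚ-cong p p′ q q′ p≈ q≈ k = trans (ℤC.coeff-+ p q k)
  (trans (cong₂ ℤ._+_ (p≈ k) (q≈ k)) (sym (ℤC.coeff-+ p′ q′ k)))

*ₚ-cong : ∀ p p′ q q′ → p ≈ₚ p′ → q ≈ₚ q′ → (p *ₚ q) ≈ₚ (p′ *ₚ q′)
*ₚ-cong p p′ q q′ p≈ q≈ k = trans (ℤC.coeff-* p q k)
  (trans (ℤC.conv-cong p≈ q≈ k) (sym (ℤC.coeff-* p′ q′ k)))

sumFin-cong : ∀ n (f g : Fin n → P) → (∀ j → f j ≈ₚ g j) → sumFin n f ≈ₚ sumFin n g
sumFin-cong zero    f g f≈g k = refl
sumFin-cong (suc n) f g f≈g =
  +ₚ-cong (f zero) (g zero) _ _ (f≈g zero) (sumFin-cong n (f ∘ suc) (g ∘ suc) (f≈g ∘ suc))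

sumFin-zero : ∀ n {f : Fin n → P} → (∀ j k → coeff (f j) k ≡ 0ℤ) → ∀ k → coeff (sumFin n f) k ≡ 0ℤ
sumFin-zero zero    f≈0 k = refl
sumFin-zero (suc n) {f} f≈0 k = trans (ℤC.coeff-+ (f zero) _ k)
  (cong₂ ℤ._+_ (f≈0 zero k) (sumFin-zero n (f≈0 ∘ suc) k))

minor : ∀ {n} → (Fin (suc n) → Fin (suc n) → P) → Fin (suc n) → Fin n → Fin n → P
minor M j i k = M (suc i) (punchIn j k)

laplaceTerm : ∀ {n} → (Fin (suc n) → Fin (suc n) → P) → Fin (suc n) → P
laplaceTerm {n} M j = (signₚ (toℕ j) *ₚ M zero j) *ₚ det n (minor M j)

det-cong : ∀ n (M N : Fin n → Fin n → P) → (∀ i j → M i j ≈ₚ N i j) → det n M ≈ₚ det n N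
det-cong zero    M N M≈N k = refl
det-cong (suc n) M N M≈N = sumFin-cong (suc n) (laplaceTerm M) (laplaceTerm N) λ j →
  *ₚ-cong (signₚ (toℕ j) *ₚ M zero j) (signₚ (toℕ j) *ₚ N zero j) (det n (minor M j)) (det n (minor N j))
    (*ₚ-cong (signₚ (toℕ j)) (signₚ (toℕ j)) (M zero j) (N zero j) (λ _ → refl) (M≈N zero j))
    (det-cong n (minor M j) (minor N j) λ i k → M≈N (suc i) (punchIn j k))

-- Laplace expansion along a row supported in its first two columns. The sign of the second column
-- meets the entry `- s`, which leaves `+ s`.
det-two-term : ∀ n (M : Fin (2 ℕ.+ n) → Fin (2 ℕ.+ n) → P) s →
  M zero (suc zero) ≈ₚ (-ₚ constₚ (+ s)) →
  (∀ j k → coeff (M zero (suc (suc j))) k ≡ 0ℤ) → ∀ k →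
  coeff (det (2 ℕ.+ n) M) k ≡
    ℤC.conv (coeff (M zero zero)) (coeff (det (suc n) (minor M zero))) k
    ℤ.+ + s ℤ.* coeff (det (suc n) (minor M (suc zero))) k
det-two-term n M s M₀₁≈-s M₀ⱼ≈0 k =
  trans (ℤC.coeff-+ (laplaceTerm M zero) (laplaceTerm M (suc zero) +ₚ rest) k) (cong₂ ℤ._+_ first
    (trans (ℤC.coeff-+ (laplaceTerm M (suc zero)) rest k)
    (trans (cong₂ ℤ._+_ second (sumFin-zero n term≈0 k)) (ℤP.+-identityʳ _))))
  where
  rest : P
  rest = sumFin n (λ j → laplaceTerm M (suc (suc j)))

  first : coeff (laplaceTerm M zero) k ≡ ℤC.conv (coeff (M zero zero)) (coeff (det (suc n) (minor M zero))) k
  first = trans (ℤC.coeff-* (oneₚ *ₚ M zero zero) (det (suc n) (minor M zero)) k)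
    (ℤC.conv-cong (λ i → trans (ℤC.coeff-* oneₚ (M zero zero) i)
      (trans (ℤC.conv-constˡ 1ℤ (coeff (M zero zero)) i) (ℤP.*-identityˡ _))) (λ _ → refl) k)

  second : coeff (laplaceTerm M (suc zero)) k ≡ + s ℤ.* coeff (det (suc n) (minor M (suc zero))) k
  second = trans (ℤC.coeff-* ((-ₚ oneₚ) *ₚ M zero (suc zero)) (det (suc n) (minor M (suc zero))) k)
    (trans (ℤC.conv-cong -M₀₁≈s (λ _ → refl) k) (ℤC.conv-constˡ (+ s) (coeff (det (suc n) (minor M (suc zero)))) k))
    where
    -M₀₁≈s : ((-ₚ oneₚ) *ₚ M zero (suc zero)) ≈ₚ constₚ (+ s)
    -M₀₁≈s i = trans (ℤC.coeff-* (-ₚ oneₚ) (M zero (suc zero)) i)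
      (trans (ℤC.conv-constˡ ℤ.-1ℤ (coeff (M zero (suc zero))) i)
      (trans (cong (ℤ.-1ℤ ℤ.*_) (M₀₁≈-s i)) (neg-neg i)))
      where
      neg-neg : ∀ i → ℤ.-1ℤ ℤ.* coeff (-ₚ constₚ (+ s)) i ≡ coeff (constₚ (+ s)) i
      neg-neg zero    = trans (ℤP.-1*i≡-i _) (ℤP.neg-involutive (+ s))
      neg-neg (suc i) = refl

  term≈0 : ∀ j i → coeff (laplaceTerm M (suc (suc j))) i ≡ 0ℤ
  term≈0 j i = trans (ℤC.coeff-* (signₚ (toℕ j) *ₚ M zero (suc (suc j))) (det (suc n) (minor M (suc (suc j)))) i)
    (ℤC.conv-zeroˡ {_} {coeff (det (suc n) (minor M (suc (suc j))))}
      (λ l → trans (ℤC.coeff-* (signₚ (toℕ j)) (M zero (suc (suc j))) l)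
        (ℤC.conv-zeroʳ {coeff (signₚ (toℕ j))} (M₀ⱼ≈0 j) l)) i)

-- The entries of the characteristic matrix are local to the `where` block of `charPoly`;
-- unification through `refl` makes them available under a name.
charPoly-det : ∀ n A → Σ (Fin n → Fin n → P) λ M → charPoly n A ≡ det n M
charPoly-det n A = _ , refl

charMatrix : ∀ {n} → Matrix n → Fin n → Fin n → P
charMatrix {n} A = proj₁ (charPoly-det n A)

charMatrix-diagonal : ∀ {n} (A : Matrix n) i → charMatrix A i i ≡ Xₚ ℤX.-ₚ constₚ (+ A i i)
charMatrix-diagonal A i with i ≟ i
... | yes _   = refl
... | no  i≢i = contradiction refl i≢i

charMatrix-offDiagonal : ∀ {n} (A : Matrix n) {i j} → i ≢ j → charMatrix A i j ≡ -ₚ constₚ (+ A i j)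
charMatrix-offDiagonal A {i} {j} i≢j with i ≟ j
... | yes i≡j = contradiction i≡j i≢j
... | no  _   = refl

charMatrix-suc : ∀ {n} (A : Matrix (suc n)) i j →
  charMatrix A (suc i) (suc j) ≡ charMatrix (λ i j → A (suc i) (suc j)) i j
charMatrix-suc A i j = by-cases (i ≟ j)
  where
  by-cases : Dec (i ≡ j) → charMatrix A (suc i) (suc j) ≡ charMatrix (λ i j → A (suc i) (suc j)) i j
  by-cases (yes refl) = trans (charMatrix-diagonal A (suc i)) (sym (charMatrix-diagonal _ i))
  by-cases (no i≢j)   = trans (charMatrix-offDiagonal A (i≢j ∘ FinP.suc-injective))
    (sym (charMatrix-offDiagonal _ i≢j))

-- As a digraph: a new vertex 0 whose only outgoing edge, of weight `s`, leads to the first old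
-- vertex, and whose incoming edges have the weights `u`.
border : ∀ {n} → ℕ → (Fin n → ℕ) → Matrix n → Matrix (suc n)
border s u A zero    zero          = 0
border s u A zero    (suc zero)    = s
border s u A zero    (suc (suc _)) = 0
border s u A (suc i) zero          = u i
border s u A (suc i) (suc j)       = A i j

replaceColumn₀ : ∀ {n} → (Fin (suc n) → P) → (Fin (suc n) → Fin (suc n) → P) → Fin (suc n) → Fin (suc n) → P
replaceColumn₀ u M i zero    = u i
replaceColumn₀ u M i (suc j) = M i (suc j)

-- Deleting the first row and second column from the characteristic matrix of a `border` leaves
-- `XI - A` with column 0 replaced by the rest of the border's first column. These determinants
-- reproduce themselves under further expansion, which makes them fit for induction.
detColumn₀ : ∀ {n} → Matrix (suc n) → (Fin (suc n) → P) → P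
detColumn₀ {n} A u = det (suc n) (replaceColumn₀ u (charMatrix A))

≡⇒≈ₚ : ∀ {p q} → p ≡ q → p ≈ₚ q
≡⇒≈ₚ refl k = refl

-- Deleting column 0 removes `u` and leaves the characteristic matrix of `A`; deleting column 1
-- keeps `u` without its top entry.
detColumn₀-border : ∀ {n} s v (A : Matrix (suc n)) u k →
  coeff (detColumn₀ (border s v A) u) k ≡
    ℤC.conv (coeff (u zero)) (coeff (charPoly (suc n) A)) k ℤ.+ + s ℤ.* coeff (detColumn₀ A (u ∘ suc)) k
detColumn₀-border {n} s v A u k = trans
  (det-two-term n M s (λ _ → refl) (λ { j zero → refl ; j (suc _) → refl }) k)
  (cong₂ (λ x y → x ℤ.+ + s ℤ.* y)
    (ℤC.conv-cong {coeff (u zero)} (λ _ → refl)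
      (det-cong (suc n) (minor M zero) (charMatrix A)
        λ i j → ≡⇒≈ₚ (charMatrix-suc (border s v A) i j)) k)
    (det-cong (suc n) (minor M (suc zero)) (replaceColumn₀ (u ∘ suc) (charMatrix A))
      (λ { i zero → λ _ → refl ; i (suc j) → ≡⇒≈ₚ (charMatrix-suc (border s v A) i (suc j)) }) k))
  where
  M : Fin (2 ℕ.+ n) → Fin (2 ℕ.+ n) → P
  M = replaceColumn₀ u (charMatrix (border s v A))

-- The instance of `detColumn₀-border` in which the replacing column is the original one, `X` above
-- `- v`.
charPoly-border : ∀ {n} s v (A : Matrix (suc n)) k →
  coeff (charPoly (2 ℕ.+ n) (border s v A)) k ≡
    ℤC.conv (coeff Xₚ) (coeff (charPoly (suc n) A)) k
    ℤ.+ + s ℤ.* coeff (detColumn₀ A (λ i → -ₚ constₚ (+ v i))) k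
charPoly-border {n} s v A k = trans
  (det-cong (2 ℕ.+ n) (charMatrix (border s v A))
    (replaceColumn₀ column (charMatrix (border s v A)))
    (λ { zero zero → λ _ → refl
       ; (suc i) zero → ≡⇒≈ₚ (charMatrix-offDiagonal (border s v A) {suc i} {zero} λ ())
       ; i (suc j) → λ _ → refl }) k)
  (detColumn₀-border s v A column k)
  where
  column : Fin (2 ℕ.+ n) → P
  column zero    = Xₚ
  column (suc i) = -ₚ constₚ (+ v i)

-- The family of matrices

-- Kronecker's delta; `δ n` serves as the coefficient sequence of Xⁿ.
δ : ℕ → ℕ → ℕ
δ zero    zero    = 1
δ zero    (suc _) = 0
δ (suc _) zero    = 0
δ (suc i) (suc j) = δ i j

δ-refl : ∀ i → δ i i ≡ 1
δ-refl zero    = refl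
δ-refl (suc i) = δ-refl i

δ-≢ : ∀ {i j} → i ≢ j → δ i j ≡ 0
δ-≢ {zero}  {zero}  i≢j = contradiction refl i≢j
δ-≢ {zero}  {suc j} i≢j = refl
δ-≢ {suc i} {zero}  i≢j = refl
δ-≢ {suc i} {suc j} i≢j = δ-≢ (i≢j ∘ cong suc)

negColumn : ∀ {n} → (Fin n → ℕ) → Fin n → P
negColumn c i = -ₚ constₚ (+ c i)

neg-*-+ : ∀ a x b y → ℤ.- + a ℤ.* + x ℤ.+ + b ℤ.* (ℤ.- + y) ≡ ℤ.- + (a * x ℕ.+ b * y)
neg-*-+ a x b y = trans
  (cong₂ ℤ._+_
    (trans (sym (ℤP.neg-distribˡ-* (+ a) (+ x))) (cong (ℤ.-_) (sym (ℤP.pos-* a x))))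
    (trans (sym (ℤP.neg-distribʳ-* (+ b) (+ y))) (cong (ℤ.-_) (sym (ℤP.pos-* b y)))))
  (sym (ℤP.neg-distrib-+ (+ (a * x)) (+ (b * y))))

path : ℕ → (r : ℕ) → Matrix (suc r)
path B zero    = λ _ _ → 0
path B (suc r) = border B (λ _ → 0) (path B r)

-- The coefficient of X^e in the sum over `i ≤ r` of Bⁱ cᵢ X^(r-i), where Bⁱ is the weight of the
-- path from its start to vertex `i`.
pathSum : ℕ → ℕ → (ℕ → ℕ) → ℕ → ℕ
pathSum B zero    c e = c 0 * δ 0 e
pathSum B (suc r) c e = c 0 * δ (suc r) e ℕ.+ B * pathSum B r (c ∘ suc) e

pathSum-zero : ∀ B r e → pathSum B r (λ _ → 0) e ≡ 0
pathSum-zero B zero    e = refl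
pathSum-zero B (suc r) e = trans (cong (B *_) (pathSum-zero B r e)) (ℕP.*-zeroʳ B)

-- The path is acyclic, so only the leading power remains. The proof is joint with
-- `detColumn₀-path`, since expanding either determinant for `suc r` leaves both for `r`.
charPoly-path : ∀ B r e → coeff (charPoly (suc r) (path B r)) e ≡ + δ (suc r) e
detColumn₀-path : ∀ B r c e →
  coeff (detColumn₀ (path B r) (negColumn (c ∘ toℕ))) e ≡ ℤ.- + pathSum B r c e

charPoly-path B zero zero          = refl
charPoly-path B zero (suc zero)    = refl
charPoly-path B zero (suc (suc e)) = refl
charPoly-path B (suc r) e = trans (charPoly-border B (λ _ → 0) (path B r) e)
  (trans (cong (λ x → ℤC.conv (coeff Xₚ) (coeff (charPoly (suc r) (path B r))) e ℤ.+ + B ℤ.* x) zero-column)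
  (trans (cong (ℤ._+_ (ℤC.conv (coeff Xₚ) (coeff (charPoly (suc r) (path B r))) e)) (ℤP.*-zeroʳ (+ B)))
  (trans (ℤP.+-identityʳ _) (shift e))))
  where
  zero-column : coeff (detColumn₀ (path B r) (negColumn (λ _ → 0))) e ≡ 0ℤ
  zero-column = trans (detColumn₀-path B r (λ _ → 0) e) (cong (λ x → ℤ.- + x) (pathSum-zero B r e))

  shift : ∀ e → ℤC.conv (coeff Xₚ) (coeff (charPoly (suc r) (path B r))) e ≡ + δ (suc (suc r)) e
  shift zero    = refl
  shift (suc e) = trans (ℤC.conv-Xˡ-suc _ e) (charPoly-path B r e)

detColumn₀-path B zero c zero = 
  trans (ℤP.+-identityʳ _) (trans (ℤP.*-identityʳ _) (trans (ℤP.+-identityʳ _) (trans (ℤP.*-identityˡ _)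
    (cong (λ x → ℤ.- + x) (sym (ℕP.*-identityʳ (c 0)))))))
detColumn₀-path B zero c (suc e) = cong (λ x → ℤ.- + x) (sym (ℕP.*-zeroʳ (c 0)))
detColumn₀-path B (suc r) c e = trans
  (detColumn₀-border B (λ _ → 0) (path B r) (negColumn (c ∘ toℕ)) e)
  (trans (cong₂ (λ x y → x ℤ.+ + B ℤ.* y)
    (trans (ℤC.conv-constˡ (ℤ.- + c 0) _ e) (cong (ℤ.- + c 0 ℤ.*_) (charPoly-path B r e)))
    (detColumn₀-path B r (c ∘ suc) e))
  (neg-*-+ (c 0) (δ (suc r) e) B (pathSum B r (c ∘ suc) e)))

-- The leading zeros belong to the vertices q: edges of weight `d` leave only from the path.
pad : ∀ t {m} → (ℕ → ℕ) → Fin (suc (t ℕ.+ m)) → ℕ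
pad zero    c i       = c (toℕ i)
pad (suc t) c zero    = 0
pad (suc t) c (suc i) = pad t c i

-- The argument counts the vertices q already placed before v. The first one added points to v
-- itself and carries the 2, so every cycle collects this factor exactly once.
weight : ℕ → ℕ
weight zero    = 2
weight (suc _) = 1

-- The vertices q are added from the one next to v outwards. The outermost is q₀, so it takes column
-- 0 of `d` and the inner matrix takes the columns shifted by one.
hess : (B m t : ℕ) → (ℕ → ℕ → ℕ) → Matrix (suc (t ℕ.+ m))
hess B m zero    d = path B m
hess B m (suc t) d = border (weight t) (pad t (λ l → d l 0)) (hess B m t (λ l k → d l (suc k)))

-- The coefficient of X^e in the sum over `i ≤ m`, `k < t` of Bⁱ d_ik X^(m-i+k), built column by
-- column as `hess` is.
cycleSum : (B m t : ℕ) → (ℕ → ℕ → ℕ) → ℕ → ℕ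
cycleSum B m zero    d e       = 0
cycleSum B m (suc t) d zero    = pathSum B m (λ l → d l 0) zero
cycleSum B m (suc t) d (suc e) =
  pathSum B m (λ l → d l 0) (suc e) ℕ.+ cycleSum B m t (λ l k → d l (suc k)) e

-- The padding zeros kill the first term of each expansion, so the column is carried along the chain
-- of vertices q to v. The weights met on the way multiply to 2, whatever `t` is.
detColumn₀-hess : ∀ B m t d c e →
  + weight t ℤ.* coeff (detColumn₀ (hess B m t d) (negColumn (pad t c))) e ≡ ℤ.- + (2 * pathSum B m c e)
detColumn₀-hess B m zero d c e = trans (cong (+ 2 ℤ.*_) (detColumn₀-path B m c e))
  (trans (sym (ℤP.neg-distribʳ-* (+ 2) _)) (cong (ℤ.-_) (sym (ℤP.pos-* 2 (pathSum B m c e)))))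
detColumn₀-hess B m (suc t) d c e = trans (ℤP.*-identityˡ _)
  (trans (detColumn₀-border (weight t) _ (hess B m t (λ l k → d l (suc k))) (negColumn (pad (suc t) c)) e)
  (trans (cong (ℤ._+ tail) (ℤC.conv-constˡ 0ℤ (coeff (charPoly _ (hess B m t d′))) e))
  (trans (ℤP.+-identityˡ tail) (detColumn₀-hess B m t d′ c e))))
  where
  d′ : ℕ → ℕ → ℕ
  d′ l k = d l (suc k)
  tail : ℤ
  tail = + weight t ℤ.* coeff (detColumn₀ (hess B m t d′) (negColumn (pad t c))) e

-- A new vertex multiplies the previous polynomial by X and subtracts the cycles that pass through
-- it, which enter it by the edges in column 0 of `d`.
charPoly-hess : ∀ B m t d e →
  coeff (charPoly (suc (t ℕ.+ m)) (hess B m t d)) e ≡ + δ (suc (t ℕ.+ m)) e ℤ.- + (2 * cycleSum B m t d e)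
charPoly-hess B m zero d e = trans (charPoly-path B m e) (sym (ℤP.+-identityʳ _))
charPoly-hess B m (suc t) d e = trans
  (charPoly-border (weight t) (pad t (λ l → d l 0)) (hess B m t (λ l k → d l (suc k))) e)
  (trans (cong (ℤ._+_ (ℤC.conv (coeff Xₚ) (coeff (charPoly _ (hess B m t (λ l k → d l (suc k))))) e)) (detColumn₀-hess B m t _ (λ l → d l 0) e)) (combine e))
  where
  d′ : ℕ → ℕ → ℕ
  d′ l k = d l (suc k)
  combine : ∀ e → ℤC.conv (coeff Xₚ) (coeff (charPoly (suc (t ℕ.+ m)) (hess B m t d′))) e
      ℤ.- + (2 * pathSum B m (λ l → d l 0) e) ≡
    + δ (suc (suc (t ℕ.+ m))) e ℤ.- + (2 * cycleSum B m (suc t) d e)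
  combine zero    = refl
  combine (suc e) = begin
    ℤC.conv (coeff Xₚ) χ (suc e) ℤ.- + (2 * x)  ≡⟨ cong (ℤ._- + (2 * x)) (trans (ℤC.conv-Xˡ-suc χ e) (charPoly-hess B m t d′ e)) ⟩
    (D ℤ.- + (2 * y)) ℤ.- + (2 * x)             ≡⟨ ℤP.+-assoc D (ℤ.- + (2 * y)) (ℤ.- + (2 * x)) ⟩
    D ℤ.+ (ℤ.- + (2 * y) ℤ.- + (2 * x))         ≡⟨ cong (λ z → D ℤ.+ z) (ℤP.neg-distrib-+ (+ (2 * y)) (+ (2 * x))) ⟨
    D ℤ.- + (2 * y ℕ.+ 2 * x)                   ≡⟨ cong (λ z → D ℤ.- + z) (trans (ℕP.+-comm (2 * y) (2 * x)) (sym (ℕP.*-distribˡ-+ 2 x y))) ⟩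
    D ℤ.- + (2 * (x ℕ.+ y))                     ∎
    where
    open ≡-Reasoning
    χ = coeff (charPoly (suc (t ℕ.+ m)) (hess B m t d′))
    D = + δ (suc (t ℕ.+ m)) e
    x = pathSum B m (λ l → d l 0) (suc e)
    y = cycleSum B m t d′ e

-- Coefficients of the cycle sum and recovery of its digits

pathSum-0 : ∀ B r c → pathSum B r c 0 ≡ B ^ r * c r
pathSum-0 B zero    c = trans (ℕP.*-identityʳ (c 0)) (sym (ℕP.*-identityˡ (c 0)))
pathSum-0 B (suc r) c = trans (cong₂ ℕ._+_ (ℕP.*-zeroʳ (c 0)) (cong (B *_) (pathSum-0 B r (c ∘ suc))))
  (sym (ℕP.*-assoc B (B ^ r) (c (suc r))))

cycleSum-0 : ∀ B m {t} d → 0 < t → cycleSum B m t d 0 ≡ B ^ m * d m 0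
cycleSum-0 B m d (s≤s _) = pathSum-0 B m (λ l → d l 0)

-- The coefficient of X^e in X^r times the sum over `k < t` of h_k X^k: what row 0 of the digits
-- contributes.
shiftedRow : ℕ → ℕ → (ℕ → ℕ) → ℕ → ℕ
shiftedRow r zero    h e       = 0
shiftedRow r (suc t) h zero    = h 0 * δ r 0
shiftedRow r (suc t) h (suc e) = h 0 * δ r (suc e) ℕ.+ shiftedRow r t (h ∘ suc) e

cycleSum-zero : ∀ B t d e → cycleSum B 0 t d e ≡ shiftedRow 0 t (d 0) e
cycleSum-zero B zero    d e       = refl
cycleSum-zero B (suc t) d zero    = refl
cycleSum-zero B (suc t) d (suc e) = cong (d 0 0 * 0 ℕ.+_) (cycleSum-zero B t (λ l k → d l (suc k)) e)

-- The same double sum grouped by rows. `cycleSum` recurses on columns to match `hess`, while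
-- decoding in base `B` needs row 0 separated from a multiple of `B`.
cycleSum-suc : ∀ B r t d e →
  cycleSum B (suc r) t d e ≡ shiftedRow (suc r) t (d 0) e ℕ.+ B * cycleSum B r t (d ∘ suc) e
cycleSum-suc B r zero    d e       = sym (ℕP.*-zeroʳ B)
cycleSum-suc B r (suc t) d zero    = refl
cycleSum-suc B r (suc t) d (suc e) = begin
  (x ℕ.+ B * y) ℕ.+ cycleSum B (suc r) t d′ e   ≡⟨ cong (x ℕ.+ B * y ℕ.+_) (cycleSum-suc B r t d′ e) ⟩
  (x ℕ.+ B * y) ℕ.+ (z ℕ.+ B * w)               ≡⟨ interchange x (B * y) z (B * w) ⟩
  (x ℕ.+ z) ℕ.+ (B * y ℕ.+ B * w)               ≡⟨ cong (x ℕ.+ z ℕ.+_) (ℕP.*-distribˡ-+ B y w) ⟨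
  (x ℕ.+ z) ℕ.+ B * (y ℕ.+ w)                   ∎
  where
  open ≡-Reasoning
  open import Algebra.Properties.CommutativeSemigroup ℕP.+-commutativeSemigroup using (interchange)
  d′ : ℕ → ℕ → ℕ
  d′ l k = d l (suc k)
  x = d 0 0 * δ (suc r) (suc e)
  y = pathSum B r (λ l → d (suc l) 0) (suc e)
  z = shiftedRow (suc r) t (d′ 0) e
  w = cycleSum B r t (d′ ∘ suc) e

shiftedRow-below : ∀ r t h {e} → e < r → shiftedRow r t h e ≡ 0
shiftedRow-below r zero    h {e}     e<r = refl
shiftedRow-below r (suc t) h {zero}  e<r =
  trans (cong (h 0 *_) (δ-≢ (ℕP.>⇒≢ e<r))) (ℕP.*-zeroʳ (h 0))
shiftedRow-below r (suc t) h {suc e} e<r = cong₂ ℕ._+_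
  (trans (cong (h 0 *_) (δ-≢ (ℕP.>⇒≢ e<r))) (ℕP.*-zeroʳ (h 0)))
  (shiftedRow-below r t (h ∘ suc) (ℕP.<-trans (ℕP.n<1+n e) e<r))

shiftedRow-above : ∀ r t h {e} → t ℕ.+ r ≤ e → shiftedRow r t h e ≡ 0
shiftedRow-above r zero    h {e}     _ = refl
shiftedRow-above r (suc t) h {suc e} (s≤s t+r≤e) = cong₂ ℕ._+_
  (trans (cong (h 0 *_) (δ-≢ (ℕP.<⇒≢ (s≤s (ℕP.≤-trans (ℕP.m≤n+m r t) t+r≤e))))) (ℕP.*-zeroʳ (h 0)))
  (shiftedRow-above r t (h ∘ suc) t+r≤e)

shiftedRow-at : ∀ r t h {k} → k < t → shiftedRow r t h (k ℕ.+ r) ≡ h k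
shiftedRow-at zero    (suc t) h {zero}  _ = ℕP.*-identityʳ (h 0)
shiftedRow-at (suc r) (suc t) h {zero}  _ = trans
  (cong₂ ℕ._+_ (trans (cong (h 0 *_) (δ-refl r)) (ℕP.*-identityʳ (h 0)))
    (shiftedRow-below (suc r) t (h ∘ suc) (ℕP.n<1+n r)))
  (ℕP.+-identityʳ (h 0))
shiftedRow-at r (suc t) h {suc k} (s≤s k<t) = cong₂ ℕ._+_
  (trans (cong (h 0 *_) (δ-≢ (ℕP.<⇒≢ (s≤s (ℕP.m≤n+m r k))))) (ℕP.*-zeroʳ (h 0)))
  (shiftedRow-at r t (h ∘ suc) k<t)

shiftedRow-cong : ∀ r t {h h′} → (∀ {k} → k < t → h k ≡ h′ k) → ∀ e →
  shiftedRow r t h e ≡ shiftedRow r t h′ e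
shiftedRow-cong r zero    h≡ e       = refl
shiftedRow-cong r (suc t) h≡ zero    = cong (_* δ r 0) (h≡ (s≤s z≤n))
shiftedRow-cong r (suc t) h≡ (suc e) =
  cong₂ ℕ._+_ (cong (_* δ r (suc e)) (h≡ (s≤s z≤n))) (shiftedRow-cong r t (h≡ ∘ s≤s) e)

cycleSum-above : ∀ B r t d {e} → t ℕ.+ r ≤ e → cycleSum B r t d e ≡ 0
cycleSum-above B zero    t d {e} t+r≤e = trans (cycleSum-zero B t d e) (shiftedRow-above 0 t (d 0) t+r≤e)
cycleSum-above B (suc r) t d {e} t+r≤e = trans (cycleSum-suc B r t d e)
  (cong₂ ℕ._+_ (shiftedRow-above (suc r) t (d 0) t+r≤e)
    (trans (cong (B *_) (cycleSum-above B r t (d ∘ suc)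
      (ℕP.≤-trans (ℕP.+-monoʳ-≤ t (ℕP.n≤1+n r)) t+r≤e))) (ℕP.*-zeroʳ B)))

digit-unique : ∀ {B x y u w} → x < B → y < B → x ℕ.+ B * u ≡ y ℕ.+ B * w → x ≡ y
digit-unique {B} {x} {y} {u} {w} x<B y<B eq = begin
  x                       ≡⟨ remainder x<B u ⟨
  (x ℕ.+ B * u) % B       ≡⟨ cong (_% B) eq ⟩
  (y ℕ.+ B * w) % B       ≡⟨ remainder y<B w ⟩
  y                       ∎
  where
  open ≡-Reasoning
  instance
    B-nonZero : ℕ.NonZero B
    B-nonZero = ℕ.>-nonZero (ℕP.≤-<-trans z≤n x<B)

  remainder : ∀ {x} → x < B → ∀ u → (x ℕ.+ B * u) % B ≡ x
  remainder {x} x<B u = trans (cong (λ v → (x ℕ.+ v) % B) (ℕP.*-comm B u))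
    (trans (ℕDM.[m+kn]%n≡m%n x u B) (ℕDM.m<n⇒m%n≡m x<B))

-- Induction on rows: row 0 consists of remainders modulo `B`, and once it is cancelled and `B`
-- divided out, the later rows pose the same problem. The conclusion stops before row `r`, which is
-- fixed throughout the family.
cycleSum-injective : ∀ B .{{_ : ℕ.NonZero B}} r t {d d′ : ℕ → ℕ → ℕ} →
  (∀ {l k} → l < r → k < t → d l k < B) → (∀ {l k} → l < r → k < t → d′ l k < B) →
  (∀ e → cycleSum B r t d e ≡ cycleSum B r t d′ e) →
  ∀ {l k} → l < r → k < t → d l k ≡ d′ l k
cycleSum-injective B zero    t _ _ _ ()
cycleSum-injective B (suc r) t {d} {d′} d<B d′<B eq = decode
  where
  eq′ : ∀ e → shiftedRow (suc r) t (d 0) e ℕ.+ B * cycleSum B r t (d ∘ suc) e ≡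
              shiftedRow (suc r) t (d′ 0) e ℕ.+ B * cycleSum B r t (d′ ∘ suc) e
  eq′ e = trans (sym (cycleSum-suc B r t d e)) (trans (eq e) (cycleSum-suc B r t d′ e))

  row₀ : ∀ {k} → k < t → d 0 k ≡ d′ 0 k
  row₀ {k} k<t = digit-unique {B} {d 0 k} (d<B (s≤s z≤n) k<t) (d′<B (s≤s z≤n) k<t)
    (subst₂ (λ x y → x ℕ.+ B * cycleSum B r t (d ∘ suc) e ≡ y ℕ.+ B * cycleSum B r t (d′ ∘ suc) e)
      (shiftedRow-at (suc r) t (d 0) k<t) (shiftedRow-at (suc r) t (d′ 0) k<t) (eq′ e))
    where
    -- Row 0 is shifted by `suc r`, so its digit `k` stands at this exponent.
    e = k ℕ.+ suc r

  rest : ∀ e → cycleSum B r t (d ∘ suc) e ≡ cycleSum B r t (d′ ∘ suc) e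
  rest e = ℕP.*-cancelˡ-≡ _ _ B (ℕP.+-cancelˡ-≡ (shiftedRow (suc r) t (d 0) e) _ _
    (trans (eq′ e) (cong (ℕ._+ B * cycleSum B r t (d′ ∘ suc) e)
      (sym (shiftedRow-cong (suc r) t row₀ e)))))

  decode : ∀ {l k} → l < suc r → k < t → d l k ≡ d′ l k
  decode {zero}  _         k<t = row₀ k<t
  decode {suc l} (s≤s l<r) k<t =
    cycleSum-injective B r t (d<B ∘ s≤s) (d′<B ∘ s≤s) rest l<r k<t

-- The last row (1, 0, …, 0), corresponding to p_m, is supplied by the empty vector.
digitOfRow : ∀ {B t} → Vec (Fin B) t → ℕ → ℕ
digitOfRow []       _       = 0
digitOfRow (x ∷ xs) zero    = toℕ x
digitOfRow (x ∷ xs) (suc k) = digitOfRow xs k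

digit : ∀ {B r t} → Vec (Vec (Fin B) t) r → ℕ → ℕ → ℕ
digit []       zero    zero    = 1
digit []       zero    (suc _) = 0
digit []       (suc _) _       = 0
digit (v ∷ vs) zero    k       = digitOfRow v k
digit (v ∷ vs) (suc l) k       = digit vs l k

digitOfRow-< : ∀ {B t} (v : Vec (Fin B) t) {k} → k < t → digitOfRow v k < B
digitOfRow-< (x ∷ v) {zero}  _         = FinP.toℕ<n x
digitOfRow-< (x ∷ v) {suc k} (s≤s k<t) = digitOfRow-< v k<t

digit-< : ∀ {B r t} (vs : Vec (Vec (Fin B) t) r) {l k} → l < r → k < t → digit vs l k < B
digit-< (v ∷ vs) {zero}  _         k<t = digitOfRow-< v k<t
digit-< (v ∷ vs) {suc l} (s≤s l<r) k<t = digit-< vs l<r k<t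

digitOfRow-≤ : ∀ {B t} (v : Vec (Fin B) t) k → digitOfRow v k ≤ B
digitOfRow-≤ []      k       = z≤n
digitOfRow-≤ (x ∷ v) zero    = ℕP.<⇒≤ (FinP.toℕ<n x)
digitOfRow-≤ (x ∷ v) (suc k) = digitOfRow-≤ v k

-- `hess-bounded` quantifies over all indices, so this bound also covers the default zeros and the
-- last row, whose entry 1 calls for `1 ≤ B`.
digit-≤ : ∀ {B r t} → 1 ≤ B → (vs : Vec (Vec (Fin B) t) r) → ∀ l k → digit vs l k ≤ B
digit-≤ 1≤B []       zero    zero    = 1≤B
digit-≤ 1≤B []       zero    (suc _) = z≤n
digit-≤ 1≤B []       (suc _) _       = z≤n
digit-≤ 1≤B (v ∷ vs) zero    k       = digitOfRow-≤ v k
digit-≤ 1≤B (v ∷ vs) (suc l) k       = digit-≤ 1≤B vs l k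

digit-last : ∀ {B r t} (vs : Vec (Vec (Fin B) t) r) → digit vs r 0 ≡ 1
digit-last []       = refl
digit-last (v ∷ vs) = digit-last vs

digitOfRow-injective : ∀ {B t} (v w : Vec (Fin B) t) →
  (∀ {k} → k < t → digitOfRow v k ≡ digitOfRow w k) → v ≡ w
digitOfRow-injective []      []      _  = refl
digitOfRow-injective (x ∷ v) (y ∷ w) eq = cong₂ _∷_
  (FinP.toℕ-injective (eq (s≤s z≤n))) (digitOfRow-injective v w (λ k<t → eq (s≤s k<t)))

digit-injective : ∀ {B r t} (vs ws : Vec (Vec (Fin B) t) r) →
  (∀ {l k} → l < r → k < t → digit vs l k ≡ digit ws l k) → vs ≡ ws
digit-injective []       []       _  = refl
digit-injective (v ∷ vs) (w ∷ ws) eq = cong₂ _∷_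
  (digitOfRow-injective v w (eq (s≤s z≤n)))
  (digit-injective vs ws (λ l<r → eq (s≤s l<r)))

border-bounded : ∀ {n H s u} {A : Matrix n} → s ≤ H → (∀ i → u i ≤ H) → Bounded n H A →
  Bounded (suc n) H (border s u A)
border-bounded s≤H u≤H A≤H zero    zero          = z≤n
border-bounded s≤H u≤H A≤H zero    (suc zero)    = s≤H
border-bounded s≤H u≤H A≤H zero    (suc (suc j)) = z≤n
border-bounded s≤H u≤H A≤H (suc i) zero          = u≤H i
border-bounded s≤H u≤H A≤H (suc i) (suc j)       = A≤H i j

path-bounded : ∀ B r → Bounded (suc r) B (path B r)
path-bounded B zero    = λ _ _ → z≤n
path-bounded B (suc r) = border-bounded ℕP.≤-refl (λ _ → z≤n) (path-bounded B r)

pad-≤ : ∀ {H} t {m c} → (∀ l → c l ≤ H) → ∀ i → pad t {m} c i ≤ H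
pad-≤ zero    c≤H i       = c≤H (toℕ i)
pad-≤ (suc t) c≤H zero    = z≤n
pad-≤ (suc t) c≤H (suc i) = pad-≤ t c≤H i

weight-≤2 : ∀ t → weight t ≤ 2
weight-≤2 zero    = ℕP.≤-refl
weight-≤2 (suc t) = s≤s z≤n

hess-bounded : ∀ {B} m t {d} → 2 ≤ B → (∀ l k → d l k ≤ B) →
  Bounded (suc (t ℕ.+ m)) B (hess B m t d)
hess-bounded {B} m zero    2≤B d≤B = path-bounded B m
hess-bounded {B} m (suc t) 2≤B d≤B = border-bounded (ℕP.≤-trans (weight-≤2 t) 2≤B)
  (pad-≤ t (λ l → d≤B l 0)) (hess-bounded m t 2≤B (λ l k → d≤B l (suc k)))

-- Enumeration of digit tables

words : ∀ {a} {A : Set a} n → List A → List (Vec A n)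
words zero    xs = [] ∷ []
words (suc n) xs = cartesianProductWith _∷_ xs (words n xs)

length-cartesianProductWith : ∀ {a b c} {A : Set a} {B : Set b} {C : Set c} (f : A → B → C) xs ys →
  length (cartesianProductWith f xs ys) ≡ length xs * length ys
length-cartesianProductWith f []       ys = refl
length-cartesianProductWith f (x ∷ xs) ys = trans (ListP.length-++ (List.map (f x) ys))
  (cong₂ ℕ._+_ (ListP.length-map (f x) ys) (length-cartesianProductWith f xs ys))

length-words : ∀ {a} {A : Set a} n (xs : List A) → length (words n xs) ≡ length xs ^ n
length-words zero    xs = refl
length-words (suc n) xs = trans (length-cartesianProductWith _∷_ xs (words n xs))
  (cong (length xs *_) (length-words n xs))

words-unique : ∀ {a} {A : Set a} n {xs : List A} → Unique xs → Unique (words n xs)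
words-unique zero    xs! = All.[] ∷ []
words-unique (suc n) xs! = Unique.cartesianProductWith⁺ _∷_ VecP.∷-injective xs! (words-unique n xs!)

-- Irreducibility by Eisenstein's criterion at 2

prime-∣-^ : ∀ {p b} → Prime p → ∀ k → p ℕD.∣ b ^ k → p ℕD.∣ b
prime-∣-^ p-prime zero    p∣1 =
  contradiction (ℕD.∣1⇒≡1 p∣1) (ℕ.nonTrivial⇒≢1 {{prime⇒nonTrivial p-prime}})
prime-∣-^ {p} {b} p-prime (suc k) p∣bᵏ⁺¹ with euclidsLemma b (b ^ k) p-prime p∣bᵏ⁺¹
... | inj₁ p∣b  = p∣b
... | inj₂ p∣bᵏ = prime-∣-^ p-prime k p∣bᵏ

-- Here `f` is Xⁿ - 2S with S of degree below `n`. If 4 divided its constant term -2Hᵐ, then 2 would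
-- divide Hᵐ and hence the odd number `H`.
eisenstein-2 : ∀ {H m n} {f : P} (S : ℕ → ℕ) → H % 2 ≡ 1 → 0 < n →
  (∀ e → coeff f e ≡ + δ n e ℤ.- + (2 * S e)) → (∀ {e} → n ≤ e → S e ≡ 0) → S 0 ≡ H ^ m →
  IrreducibleOverℚ f
eisenstein-2 {H} {m} {n} {f} S H-odd 0<n coeff-f S-above S-0 = eisenstein {2} {n} f prime[2] 0<n
  (λ e e<n → subst (+ 2 ∣_) (sym (coeff-low e<n)) (∣m⇒∣-m (∣ᵤ⇒∣ (ℕD.m∣m*n (S e)))))
  (λ 2∣1 → contradiction (ℕD.∣1⇒≡1 (∣⇒∣ᵤ (subst (+ 2 ∣_) coeff-lead 2∣1))) λ ())
  (λ e n<e → trans (coeff-f e)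
    (cong₂ (λ x y → + x ℤ.- + (2 * y)) (δ-≢ (ℕP.<⇒≢ n<e)) (S-above (ℕP.<⇒≤ n<e))))
  (λ 4∣f₀ → 2∤H (prime-∣-^ prime[2] m (ℕD.*-cancelˡ-∣ 2 (subst (λ x → 4 ℕD.∣ 2 * x) S-0
    (subst (4 ℕD.∣_) (ℤP.∣-i∣≡∣i∣ (+ (2 * S 0))) (∣⇒∣ᵤ (subst (+ 4 ∣_) (coeff-low 0<n) 4∣f₀)))))))
  where
  coeff-lead : coeff f n ≡ 1ℤ
  coeff-lead = trans (coeff-f n)
    (cong₂ (λ x y → + x ℤ.- + (2 * y)) (δ-refl n) (S-above ℕP.≤-refl))

  coeff-low : ∀ {e} → e < n → coeff f e ≡ ℤ.- + (2 * S e)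
  coeff-low {e} e<n = trans (coeff-f e)
    (trans (cong (λ x → + x ℤ.- + (2 * S e)) (δ-≢ (ℕP.>⇒≢ e<n))) (ℤP.+-identityˡ _))

  2∤H : ¬ (2 ℕD.∣ H)
  2∤H 2∣H = contradiction (trans (sym (ℕD.n∣m⇒m%n≡0 H 2 2∣H)) H-odd) λ ()

-- The family of polynomials and its size

hessPoly : (H m : ℕ) → Vec (Vec (Fin H) m) m → P
hessPoly H m vs = charPoly (suc (m ℕ.+ m)) (hess H m m (digit vs))

open import Algebra.Properties.Group (AbelianGroup.group ℤP.+-0-abelianGroup) using (∙-cancelˡ)

module _ {H : ℕ} (2≤H : 2 ≤ H) (H-odd : H % 2 ≡ 1) {m : ℕ} (0<m : 0 < m) where
  private
    instance
      H-nonZero : ℕ.NonZero H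
      H-nonZero = ℕ.>-nonZero (ℕP.<-trans (s≤s z≤n) 2≤H)

  hessPoly-injective : ∀ {vs ws} → hessPoly H m vs ≈ₚ hessPoly H m ws → vs ≡ ws
  hessPoly-injective {vs} {ws} eq = digit-injective vs ws
    (cycleSum-injective H m m (digit-< vs) (digit-< ws) λ e →
      ℕP.*-cancelˡ-≡ _ _ 2 (ℤP.+-injective (ℤP.neg-injective
        (∙-cancelˡ (+ δ (suc (m ℕ.+ m)) e) (ℤ.- + (2 * cycleSum H m m (digit vs) e))
          (ℤ.- + (2 * cycleSum H m m (digit ws) e))
          (trans (sym (charPoly-hess H m m (digit vs) e))
            (trans (eq e) (charPoly-hess H m m (digit ws) e)))))))

  hessPoly-irreducible : ∀ vs → IrreducibleOverℚ (hessPoly H m vs)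
  hessPoly-irreducible vs = eisenstein-2 {H} {m} {suc (m ℕ.+ m)} {hessPoly H m vs}
    (cycleSum H m m (digit vs)) H-odd (s≤s z≤n) (charPoly-hess H m m (digit vs))
    -- The cycle sum vanishes from exponent 2m on, one below the degree.
    (λ n≤e → cycleSum-above H m m (digit vs) (ℕP.<⇒≤ n≤e))
    (trans (cycleSum-0 H m (digit vs) 0<m)
      (trans (cong (H ^ m *_) (digit-last vs)) (ℕP.*-identityʳ (H ^ m))))

  hessPoly-InI : ∀ vs → InI (suc (m ℕ.+ m)) H (hessPoly H m vs)
  hessPoly-InI vs = hessPoly-irreducible vs , hess H m m (digit vs) ,
    hess-bounded m m 2≤H (digit-≤ (ℕP.<⇒≤ 2≤H) vs) , λ _ → refl

  irreducible-charPolys : Σ (List P) λ fs →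
    AllPairs (λ f g → ¬ (f ≈ₚ g)) fs × All (InI (suc (m ℕ.+ m)) H) fs × length fs ≡ H ^ (m * m)
  irreducible-charPolys = List.map (hessPoly H m) digits ,
    AllPairsP.map⁺ (AllPairs.map (λ vs≢ws eq → vs≢ws (hessPoly-injective eq))
      (words-unique m (words-unique m (Unique.allFin⁺ H)))) ,
    AllP.map⁺ (All.universal hessPoly-InI digits) ,
    trans (ListP.length-map (hessPoly H m) digits) (trans (length-words m (words m (allFin H)))
      (trans (cong (_^ m) (trans (length-words m (allFin H)) (cong (_^ m) (ListP.length-tabulate id))))
        (ℕP.^-*-assoc H m m)))
    where
    digits : List (Vec (Vec (Fin H) m) m)
    digits = words m (words m (allFin H))

odd-half : ∀ n → n % 2 ≡ 1 → n ≡ suc (n / 2 ℕ.+ n / 2)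
odd-half n n-odd = trans (ℕDM.m≡m%n+[m/n]*n n 2) (cong₂ ℕ._+_ n-odd
  (trans (ℕP.*-comm (n / 2) 2) (cong (n / 2 ℕ.+_) (ℕP.+-identityʳ (n / 2)))))

quarter-square : ∀ m → (m ℕ.+ m) * (m ℕ.+ m) / 4 ≡ m * m
quarter-square m = trans (cong (_/ 4) (trans (cong (λ x → x * x) m+m≡m*2) (interchange m 2 m 2)))
  (ℕDM.m*n/n≡m (m * m) 4)
  where
  open import Algebra.Properties.CommutativeSemigroup ℕP.*-commutativeSemigroup using (interchange)
  m+m≡m*2 : m ℕ.+ m ≡ m * 2
  m+m≡m*2 = trans (cong (m ℕ.+_) (sym (ℕP.+-identityʳ m))) (ℕP.*-comm 2 m)

-- The denominator 2n is multiplied across to stay within ℕ. For n = 2m + 1 the exponent is exactly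
-- m², and the rest follows from `H ∸ 1 ≤ H` and from a positive multiple of `ℓ` being at least `ℓ`.
count-bound : ∀ m H {ℓ} → ℓ ≡ H ^ (m * m) →
  (H ∸ 1) ^ ((m ℕ.+ m) * (m ℕ.+ m) / 4) ≤ 2 * suc (m ℕ.+ m) * ℓ
count-bound m H {ℓ} ℓ≡ = begin
  (H ∸ 1) ^ ((m ℕ.+ m) * (m ℕ.+ m) / 4)   ≡⟨ cong ((H ∸ 1) ^_) (quarter-square m) ⟩
  (H ∸ 1) ^ (m * m)                       ≤⟨ ℕP.^-monoˡ-≤ (m * m) (ℕP.m∸n≤m H 1) ⟩
  H ^ (m * m)                             ≡⟨ ℓ≡ ⟨
  ℓ                                       ≤⟨ ℕP.m≤n*m ℓ (2 * suc (m ℕ.+ m)) ⟩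
  2 * suc (m ℕ.+ m) * ℓ                   ∎
  where open ℕP.≤-Reasoning

theorem1p2 : (n H : ℕ) → 5 ≤ n → n % 2 ≡ 1 → 3 ≤ H → H % 2 ≡ 1 →
    Σ (List ℤX.P) (λ fs →
    AllPairs (λ f g → ¬ (f ℤX.≈ₚ g)) fs × All (InI n H) fs ×
    (H ∸ 1) ^ (((n ∸ 1) * (n ∸ 1)) / 4) ≤ (2 * n) * length fs)
theorem1p2 n H 5≤n n-odd 3≤H H-odd = subst Conclusion (sym n≡2m+1) conclusion
  where
  m = n / 2

  n≡2m+1 : n ≡ suc (m ℕ.+ m)
  n≡2m+1 = odd-half n n-odd

  0<m : 0 < m
  0<m = ℕDM.m≥n⇒m/n>0 (ℕP.≤-trans (s≤s (s≤s z≤n)) 5≤n)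

  Conclusion : ℕ → Set
  Conclusion n = Σ (List ℤX.P) (λ fs →
    AllPairs (λ f g → ¬ (f ℤX.≈ₚ g)) fs × All (InI n H) fs ×
    (H ∸ 1) ^ (((n ∸ 1) * (n ∸ 1)) / 4) ≤ (2 * n) * length fs)

  conclusion : Conclusion (suc (m ℕ.+ m))
  conclusion = let fs , distinct , irreducible , count = irreducible-charPolys (ℕP.<⇒≤ 3≤H) H-odd {m} 0<m
    in fs , distinct , irreducible , count-bound m H count
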